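{- A (finite, simple, undirected) graph $G=(V,E)$ is hereditarily ergodic if and only if $G$ is switchable.
   Context: A perfect matching of a graph $G=(V,E)$ is a set of pairwise disjoint edges covering every vertex; the empty graph has the unique perfect matching $\emptyset$. The transition graph $\mathcal{G}(G)$ of the switch chain has one vertex for each perfect matching of $G$; two perfect matchings $M,M'$ are adjacent iff they differ by a single switch, i.e. there are edges $uv,u'v'\in M$ such that $u'v,uv'\in E$ and $M'=(M\setminus\{uv,u'v'\})\cup\{u'v,uv'\}$. $G$ is ergodic if $\mathcal{G}(G)$ is connected (a graph with no vertices counts as connected). $G$ is hereditarily ergodic if the induced subgraph $G[U]$ is ergodic for every $U\subseteq V$. Let $C$ be an even cycle (not necessarily induced) of length $2r$ in $G$ with vertices numbered consecutively $v_1,v_2,\ldots,v_{2r}$ around $C$. A chord of $C$ is an edge $v_iv_j$ of $G$ joining two vertices of $C$ that is not an edge of $C$; it is odd if $j-i$ is odd and even if $j-i$ is even. An even switch of $C$ is given (for some choice of consecutive numbering of the vertices of $C$, with any starting vertex and direction) by indices $1\le i<j\le r$ such that $v_{2i-1}v_{2j-1}\in E$ and $v_{2i}v_{2j}\in E$; that is, a 4-cycle formed by the two cycle edges $v_{2i-1}v_{2i}$, $v_{2j-1}v_{2j}$ and the two even chords $v_{2i-1}v_{2j-1}$, $v_{2i}v_{2j}$. Deleting the edges $v_{2i-1}v_{2i}$, $v_{2j-1}v_{2j}$ divides $C$ into two vertex-disjoint paths $P_1$ (from $v_{2i}$ to $v_{2j-1}$) and $P_2$ (from $v_{2j}$ through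 $v_{2r},v_1$ to $v_{2i-1}$), endpoints included. A crossing chord of this even switch is a chord $v_kv_l$ of $C$, other than the two chords $v_{2i-1}v_{2j-1}$, $v_{2i}v_{2j}$ of the switch itself, with $v_k\in P_1$ and $v_l\in P_2$. $G$ is switchable if every even cycle of length at least 6 in $G$ has an odd chord, or has an even switch with a crossing chord. -}

module Defs where

open import Data.Fin using (Fin; toℕ; combine; _≤_; _<_)
open import Data.Fin.Patterns using (0F; 1F)
open import Data.Fin.Subset using (Subset; _∈_)
open import Data.Nat as ℕ using (ℕ; suc; ∣_-_∣)
open import Data.Nat.Divisibility using (_∤_)
open import Data.Product using (Σ; ∃; ∃₂; _×_; proj₁)
open import Data.Sum using (_⊎_)
open import Function.Definitions using (Injective)
open import Level using (0ℓ)
open import Relation.Binary.Construct.Closure.ReflexiveTransitive using (Star)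
open import Relation.Binary.Construct.Union using (_∪_)
open import Relation.Binary.Core using (Rel; _⇒_; _⇔_)
open import Relation.Binary.Definitions using (Decidable; Symmetric)
open import Relation.Binary.PropositionalEquality using (_≡_)
open import Relation.Nullary using (¬_)

-- Finiteness is not a field: finite graphs are those on V = Fin n and their
-- induced subgraphs.
record Graph (V : Set) : Set₁ where
  infix 4 _~_ _~?_
  field
    _~_       : Rel V 0ℓ
    _~?_      : Decidable _~_
    symmetric : Symmetric _~_
    loopless  : ∀ {v} → ¬ v ~ v

-- Membership in a Subset is proof-irrelevant, so the vertices of G [ U ] are
-- exactly the elements of U.
_[_] : ∀ {n} → Graph (Fin n) → (U : Subset n) → Graph (Σ (Fin n) (_∈ U))
G [ U ] = record
  { _~_       = λ u v → proj₁ u ~ proj₁ v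
  ; _~?_      = λ u v → proj₁ u ~? proj₁ v
  ; symmetric = symmetric
  ; loopless  = loopless
  }
  where open Graph G

-- Sets of unordered pairs are encoded as symmetric relations; ⟦ u , v ⟧ is the
-- singleton {uv}.
⟦_,_⟧ : {V : Set} → V → V → Rel V 0ℓ
⟦ u , v ⟧ x y = (x ≡ u × y ≡ v) ⊎ (x ≡ v × y ≡ u)

infixl 7 _∖_
_∖_ : {V : Set} → Rel V 0ℓ → Rel V 0ℓ → Rel V 0ℓ
(P ∖ Q) x y = P x y × ¬ Q x y

record PerfectMatching {V : Set} (G : Graph V) : Set₁ where
  open Graph G using (_~_)
  field
    edges     : Rel V 0ℓ
    symmetric : Symmetric edges
    edges⊆E   : edges ⇒ _~_
    disjoint  : ∀ {u v w} → edges u v → edges u w → v ≡ w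
    covering  : ∀ u → ∃ λ v → edges u v

module _ {V : Set} (G : Graph V) where
  open Graph G using (_~_)
  open PerfectMatching using (edges)

  Switch : Rel (PerfectMatching G) 0ℓ
  Switch M M′ = ∃₂ λ u v → ∃₂ λ u′ v′ →
    edges M u v × edges M u′ v′ × ¬ ⟦ u , v ⟧ u′ v′ ×
    u′ ~ v × u ~ v′ ×
    edges M′ ⇔ (edges M ∖ (⟦ u , v ⟧ ∪ ⟦ u′ , v′ ⟧)) ∪ (⟦ u′ , v ⟧ ∪ ⟦ u , v′ ⟧)

  -- Perfect matchings are identified when they have the same edges, which
  -- without function extensionality is weaker than _≡_; hence the endpoint N.
  Ergodic : Set₁
  Ergodic = ∀ (M M′ : PerfectMatching G) → ∃ λ N → Star Switch M N × edges N ⇔ edges M′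

HereditarilyErgodic : ∀ {n} → Graph (Fin n) → Set₁
HereditarilyErgodic {n} G = (U : Subset n) → Ergodic (G [ U ])

-- j is the cyclic successor of i.
Next : ∀ {m} → Rel (Fin m) 0ℓ
Next {m} i j = toℕ j ≡ suc (toℕ i) ⊎ (suc (toℕ i) ≡ m × toℕ j ≡ 0)

-- A cycle of length m together with a consecutive numbering of its vertices,
-- starting from 0.
record Cycle {V : Set} (G : Graph V) (m : ℕ) : Set where
  open Graph G using (_~_)
  field
    3≤m       : 3 ℕ.≤ m
    vertex    : Fin m → V
    injective : Injective _≡_ _≡_ vertex
    adjacent  : ∀ {i j} → Next i j → vertex i ~ vertex j

  cycleEdges : Rel V 0ℓ
  cycleEdges x y = ∃₂ λ i j → Next i j × ⟦ vertex i , vertex j ⟧ x y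

module _ {V : Set} {G : Graph V} where
  open Graph G using (_~_)
  open Cycle

  -- The same cycle of G, possibly with another starting vertex or direction.
  SameCycle : ∀ {m} → Rel (Cycle G m) 0ℓ
  SameCycle C D = cycleEdges C ⇔ cycleEdges D

  Chord : ∀ {m} → Cycle G m → Rel (Fin m) 0ℓ
  Chord C k l = vertex C k ~ vertex C l × ¬ cycleEdges C (vertex C k) (vertex C l)

  HasOddChord : ∀ {m} → Cycle G m → Set
  HasOddChord C = ∃₂ λ k l → Chord C k l × 2 ∤ ∣ toℕ k - toℕ l ∣

  -- For i : Fin r, the positions 2i and 2i + 1 on a cycle of length r * 2. In
  -- 1-based numbering, with i also counted from 1, these are 2i - 1 and 2i.
  fst snd : ∀ {r} → Fin r → Fin (r ℕ.* 2)
  fst i = combine i 0F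
  snd i = combine i 1F

  EvenSwitch : ∀ {r} → Cycle G (r ℕ.* 2) → Rel (Fin r) 0ℓ
  EvenSwitch C i j =
    i < j ×
    vertex C (fst i) ~ vertex C (fst j) ×
    vertex C (snd i) ~ vertex C (snd j)

  -- The positions of k and l put vertex k on the path P₁ and vertex l on the
  -- path P₂ left after deleting the two cycle edges of the switch.
  CrossingChord : ∀ {r} → Cycle G (r ℕ.* 2) → (i j : Fin r) → Rel (Fin (r ℕ.* 2)) 0ℓ
  CrossingChord C i j k l =
    Chord C k l ×
    ¬ ⟦ fst i , fst j ⟧ k l ×
    ¬ ⟦ snd i , snd j ⟧ k l ×
    (snd i ≤ k × k ≤ fst j) ×
    (snd j ≤ l ⊎ l ≤ fst i)

  -- An even switch is given by some renumbering D of C.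
  HasCrossedEvenSwitch : ∀ {r} → Cycle G (r ℕ.* 2) → Set
  HasCrossedEvenSwitch {r} C =
    Σ (Cycle G (r ℕ.* 2)) λ D → SameCycle C D ×
      (∃₂ λ (i j : Fin r) → EvenSwitch D i j × ∃₂ (CrossingChord D i j))

Switchable : ∀ {V} → Graph V → Set
Switchable G = ∀ r → 6 ℕ.≤ r ℕ.* 2 → (C : Cycle G (r ℕ.* 2)) →
  HasOddChord C ⊎ HasCrossedEvenSwitch {r = r} C

{-# OPTIONS --safe #-}
-- Switchable implies ergodic: induct on the number of vertices whose mates in X
-- and Y differ. An alternating cycle of X and Y with an odd chord is split by
-- the chord into two shorter alternating cycles, that is, some matching lies
-- strictly between X and Y. Performing an even switch on X replaces the cycle by
-- the one in which the path P₁ is reversed; this shifts the parity of positions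
-- on P₁ only, so the crossing chord becomes odd.
--
-- Ergodic implies switchable: in the subgraph induced by a cycle C without odd
-- chords, the first switch applied to one of the two perfect matchings of C is
-- an even switch. If it has no crossing chord, then P₁ is joined to P₂ only by
-- the four edges of the switch, and every matching reachable from this one
-- contains two opposite edges of that 4-cycle, unlike the other matching of C.
module Submission where

open import Defs
open import Data.Nat using (ℕ)
open import Data.Fin using (Fin)
open import Function.Bundles using (_⇔_; mk⇔)
open import Data.Fin as Fin using (toℕ)
open import Data.Fin.Properties as Fin using (toℕ<n; toℕ-injective; toℕ-combine; toℕ-fromℕ<; pigeonhole)
open import Data.Fin.Subset as Subset using (Subset)
open import Data.Fin.Subset.Properties using (_∈?_)
open import Data.List using (List; []; _∷_; length; filter; lookup; allFin; concatMap)
open import Data.List.Membership.Propositional using (_∈_; lose)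
open import Data.List.Membership.Propositional.Properties using (∈-allFin; ∈-concatMap⁺)
open import Data.List.Relation.Unary.Any using (here; there; index; any?; satisfied)
open import Data.List.Relation.Unary.Any.Properties using (lookup-index)
open import Data.Nat as ℕ using (zero; suc; _+_; _*_; _∸_; _≤_; _<_; z≤n; s≤s; s≤s⁻¹; ∣_-_∣; parity)
open import Data.Nat.Divisibility using (_∣_; _∤_; _∣?_; divides)
open import Data.Nat.DivMod using (_mod_; m<n⇒m%n≡m)
open import Data.Nat.Induction using (<-rec)
open import Data.Nat.Properties hiding (_≟_)
open import Data.Parity.Base as ℙ using (Parity; 0ℙ; 1ℙ; _⁻¹)
import Data.Parity.Properties as ℙ
open import Data.Product using (Σ; ∃; ∃₂; _×_; _,_; proj₁; proj₂; swap)
open import Data.Sum using (_⊎_; inj₁; inj₂; [_,_]′)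
open import Data.Vec using (tabulate)
open import Data.Vec.Properties using (lookup∘tabulate; lookup⇒[]=; []=⇒lookup)
open import Data.Vec.Properties.WithK using ([]=-irrelevant)
open import Function using (_∘_; id; case_of_)
open import Level using (0ℓ)
open import Relation.Binary.Construct.Closure.ReflexiveTransitive using (Star; ε; _◅_; _◅◅_; reverse)
open import Relation.Binary.Construct.Union using (_∪_)
open import Relation.Binary.Core using (Rel; _⇒_)
open import Relation.Binary.Definitions using (DecidableEquality; tri<; tri≈; tri>)
open import Relation.Binary.PropositionalEquality hiding ([_])
open import Relation.Nullary using (¬_; Dec; does; yes; no; ¬?; contradiction; _×-dec_; _⊎-dec_)
open import Relation.Nullary.Decidable using (decidable-stable; dec-true)
open import Relation.Unary using (Pred; Decidable)

-- An even switch need not bring `X` closer to `Y`. It does not take them further apart either,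
-- since its four corners lie on the alternating cycle, where the matchings disagree already; the
-- odd chord that it creates then yields the strict descent. The induction step is therefore kept as
-- a predicate `Step` that tolerates such a preliminary switch. `Step` is also symmetric, because
-- switches are reversible, so it never matters which matching owns the first edge of a cycle.
-- Alternating cycles of length four, on which switchability is silent, are themselves switches.
--
-- In the converse, the absence of odd chords is what protects the invariant: a switch could destroy
-- it only by using both diagonals of the 4-cycle at once. These join positions of opposite parity,
-- so both would be edges of `C`, and `C` would have length four. The case distinctions on chords
-- are decidable, so the crossing chord is found by search.

module _ {A : Set} {P Q : Pred A 0ℓ} (P? : Decidable P) (Q? : Decidable Q)
         (P⊆Q : ∀ {x} → P x → Q x) where

  count-mono : ∀ xs → length (filter P? xs) ≤ length (filter Q? xs)
  count-mono [] = z≤n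
  count-mono (x ∷ xs) with P? x | Q? x
  ... | yes p | yes q = s≤s (count-mono xs)
  ... | yes p | no ¬q = contradiction (P⊆Q p) ¬q
  ... | no ¬p | yes q = m≤n⇒m≤1+n (count-mono xs)
  ... | no ¬p | no ¬q = count-mono xs

  count-mono-< : ∀ {x xs} → x ∈ xs → ¬ P x → Q x → length (filter P? xs) < length (filter Q? xs)
  count-mono-< {x} (here {xs = xs} refl) ¬p q with P? x | Q? x
  ... | yes p | _     = contradiction p ¬p
  ... | no _  | yes _ = s≤s (count-mono xs)
  ... | no _  | no ¬q = contradiction q ¬q
  count-mono-< {xs = y ∷ xs} (there x∈xs) ¬p q with P? y | Q? y
  ... | yes p′ | yes q′ = s≤s (count-mono-< x∈xs ¬p q)
  ... | yes p′ | no ¬q′ = contradiction (P⊆Q p′) ¬q′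
  ... | no _   | yes _  = m≤n⇒m≤1+n (count-mono-< x∈xs ¬p q)
  ... | no _   | no _   = count-mono-< x∈xs ¬p q

-- Perfect matchings, switches and reachability

module Matchings {V : Set} (_≟_ : DecidableEquality V) (G : Graph V) where
  open Graph G using (_~_; loopless) renaming (symmetric to ~-sym)
  open module Matching (M : PerfectMatching G) = PerfectMatching M public

  PM : Set₁
  PM = PerfectMatching G

  mate : PM → V → V
  mate M u = proj₁ (covering M u)

  mate-edge : ∀ M u → edges M u (mate M u)
  mate-edge M u = proj₂ (covering M u)

  mate-unique : ∀ M {u v} → edges M u v → mate M u ≡ v
  mate-unique M = disjoint M (mate-edge M _)

  disjointˡ : ∀ M {u v w} → edges M u w → edges M v w → u ≡ v
  disjointˡ M a b = disjoint M (symmetric M a) (symmetric M b)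

  unmatched-self : ∀ M {u} → ¬ edges M u u
  unmatched-self M {u} uu = loopless {u} (edges⊆E M uu)

  infix 4 _≈_
  _≈_ : Rel PM 0ℓ
  M ≈ N = (edges M ⇒ edges N) × (edges N ⇒ edges M)

  -- Inclusion suffices, as both matchings cover every vertex.
  ⊆⇒≈ : ∀ {M N} → edges M ⇒ edges N → M ≈ N
  ⊆⇒≈ {M} {N} M⊆N = M⊆N , λ {u} {v} n →
    subst (edges M u) (disjoint N (M⊆N (mate-edge M u)) n) (mate-edge M u)

  record Reach (M N : PM) : Set₁ where
    constructor reach
    field
      {target} : PM
      switches : Star (Switch G) M target
      reached  : target ≈ N

  switch-respˡ : ∀ M N K → M ≈ N → Switch G M K → Switch G N K
  switch-respˡ M N K (M⊆N , N⊆M) (u , v , u′ , v′ , uv , u′v′ , ≢ , u′~v , u~v′ , K⊆ , K⊇) =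
    u , v , u′ , v′ , M⊆N uv , M⊆N u′v′ , ≢ , u′~v , u~v′ ,
    (λ k → [ (λ (m , ∉) → inj₁ (M⊆N m , ∉)) , inj₂ ]′ (K⊆ k)) ,
    [ (λ (n , ∉) → K⊇ (inj₁ (N⊆M n , ∉))) , K⊇ ∘ inj₂ ]′

  -- Only the first switch mentions the starting matching, so only that switch is rebuilt.
  reach-respˡ : ∀ {M N K} → M ≈ N → Reach M K → Reach N K
  reach-respˡ (M⊆N , N⊆M) (reach ε (M⊆K , K⊆M)) = reach ε (M⊆K ∘ N⊆M , M⊆N ∘ K⊆M)
  reach-respˡ {M} {N} M≈N (reach (_◅_ {j = L} s ss) ≈K) =
    reach (switch-respˡ M N L M≈N s ◅ ss) ≈K

  reach-trans : ∀ {M N K} → Reach M N → Reach N K → Reach M K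
  reach-trans {N = N} {K} (reach {T} ss T≈N) N↝K with reach ss′ ≈K ← reach-respˡ {N} {T} {K} (swap T≈N) N↝K =
    reach (ss ◅◅ ss′) ≈K

  -- Containment of the new and the kept edges in `M′` is enough: they already cover every vertex,
  -- and disjointness of `M′` leaves room for nothing else.
  switch-intro : ∀ M M′ {u v u′ v′} → edges M u v → edges M u′ v′ → u ≢ u′ →
    edges M′ u′ v → edges M′ u v′ →
    (∀ {x y} → edges M x y → ¬ (⟦ u , v ⟧ ∪ ⟦ u′ , v′ ⟧) x y → edges M′ x y) →
    Switch G M M′
  switch-intro M M′ {u} {v} {u′} {v′} uv u′v′ u≢u′ u′v uv′ kept =
    u , v , u′ , v′ , uv , u′v′ ,
    [ (λ (e , _) → u≢u′ (sym e)) , (λ { (refl , _) → unmatched-self M′ u′v }) ]′ ,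
    edges⊆E M′ u′v , edges⊆E M′ uv′ , to , from
    where
    to : edges M′ ⇒ (edges M ∖ (⟦ u , v ⟧ ∪ ⟦ u′ , v′ ⟧)) ∪ (⟦ u′ , v ⟧ ∪ ⟦ u , v′ ⟧)
    to {x} {y} m with x ≟ u | x ≟ v | x ≟ u′ | x ≟ v′
    ... | yes refl | _ | _ | _ = inj₂ (inj₂ (inj₁ (refl , disjoint M′ m uv′)))
    ... | no _ | yes refl | _ | _ = inj₂ (inj₁ (inj₂ (refl , disjoint M′ m (symmetric M′ u′v))))
    ... | no _ | no _ | yes refl | _ = inj₂ (inj₁ (inj₁ (refl , disjoint M′ m u′v)))
    ... | no _ | no _ | no _ | yes refl = inj₂ (inj₂ (inj₂ (refl , disjoint M′ m (symmetric M′ uv′))))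
    ... | no ≢u | no ≢v | no ≢u′ | no ≢v′ =
      inj₁ (subst (edges M x) (disjoint M′ (kept (mate-edge M x) ∉) m) (mate-edge M x) , ∉)
      where
      ∉ : ∀ {y} → ¬ (⟦ u , v ⟧ ∪ ⟦ u′ , v′ ⟧) x y
      ∉ (inj₁ (inj₁ (e , _))) = ≢u e
      ∉ (inj₁ (inj₂ (e , _))) = ≢v e
      ∉ (inj₂ (inj₁ (e , _))) = ≢u′ e
      ∉ (inj₂ (inj₂ (e , _))) = ≢v′ e
    from : (edges M ∖ (⟦ u , v ⟧ ∪ ⟦ u′ , v′ ⟧)) ∪ (⟦ u′ , v ⟧ ∪ ⟦ u , v′ ⟧) ⇒ edges M′
    from (inj₁ (m , ∉)) = kept m ∉
    from (inj₂ (inj₁ (inj₁ (refl , refl)))) = u′v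
    from (inj₂ (inj₁ (inj₂ (refl , refl)))) = symmetric M′ u′v
    from (inj₂ (inj₂ (inj₁ (refl , refl)))) = uv′
    from (inj₂ (inj₂ (inj₂ (refl , refl)))) = symmetric M′ uv′

  switch-sym : ∀ {M M′} → Switch G M M′ → Switch G M′ M
  switch-sym {M} {M′} (u , v , u′ , v′ , uv , u′v′ , ≢ , u′~v , u~v′ , M′⊆ , M′⊇) =
    switch-intro M′ M (M′⊇ (inj₂ (inj₂ (inj₁ (refl , refl))))) (M′⊇ (inj₂ (inj₁ (inj₁ (refl , refl)))))
      (λ { refl → ≢ (inj₁ (refl , disjoint M u′v′ uv)) }) u′v′ uv kept
    where
    kept : ∀ {x y} → edges M′ x y → ¬ (⟦ u , v′ ⟧ ∪ ⟦ u′ , v ⟧) x y → edges M x y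
    kept m ∉ with M′⊆ m
    ... | inj₁ (m′ , _) = m′
    ... | inj₂ (inj₁ e) = contradiction (inj₂ e) ∉
    ... | inj₂ (inj₂ e) = contradiction (inj₁ e) ∉

  reach-sym : ∀ {M N} → Reach M N → Reach N M
  reach-sym {N = N} (reach {K} ss K≈N) =
    reach-respˡ {K} K≈N (reach (reverse (λ {M} {M′} → switch-sym {M} {M′}) ss) (id , id))

  Agree : PM → PM → Pred V 0ℓ
  Agree X Y u = mate X u ≡ mate Y u

  agree? : ∀ X Y → Decidable (Agree X Y)
  agree? X Y u = mate X u ≟ mate Y u

  agree-intro : ∀ X Y {u v} → edges X u v → edges Y u v → Agree X Y u
  agree-intro X Y uv uv′ = trans (mate-unique X uv) (sym (mate-unique Y uv′))

  agree-edge : ∀ X Y {u v} → Agree X Y u → edges X u v → edges Y u v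
  agree-edge X Y {u} e uv = subst (edges Y u) (trans (sym e) (mate-unique X uv)) (mate-edge Y u)

  module Switched (M : PM) {u v u′ v′ : V} (uv : edges M u v) (u′v′ : edges M u′ v′)
                  (u≢u′ : u ≢ u′) (u≢v′ : u ≢ v′) (u′~v : u′ ~ v) (u~v′ : u ~ v′) where
    private
      u≢v : u ≢ v
      u≢v refl = unmatched-self M uv
      u′≢v′ : u′ ≢ v′
      u′≢v′ refl = unmatched-self M u′v′
      u′≢v : u′ ≢ v
      u′≢v refl = u≢v′ (disjoint M (symmetric M uv) u′v′)

      τ : V → V
      τ x with x ≟ v | x ≟ v′
      ... | yes _ | _     = v′
      ... | no _  | yes _ = v
      ... | no _  | no _  = x

      τ-v : τ v ≡ v′
      τ-v with v ≟ v
      ... | yes _ = refl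
      ... | no ≢  = contradiction refl ≢

      τ-v′ : τ v′ ≡ v
      τ-v′ with v′ ≟ v | v′ ≟ v′
      ... | yes e | _     = e
      ... | no _  | yes _ = refl
      ... | no _  | no ≢  = contradiction refl ≢

      τ-fixed : ∀ {x} → x ≢ v → x ≢ v′ → τ x ≡ x
      τ-fixed {x} ≢v ≢v′ with x ≟ v | x ≟ v′
      ... | yes e | _     = contradiction e ≢v
      ... | no _  | yes e = contradiction e ≢v′
      ... | no _  | no _  = refl

      τ-involutive : ∀ x → τ (τ x) ≡ x
      τ-involutive x = helper (x ≟ v) (x ≟ v′)
        where
        helper : Dec (x ≡ v) → Dec (x ≡ v′) → τ (τ x) ≡ x
        helper (yes refl) _          = trans (cong τ τ-v) τ-v′
        helper (no _)     (yes refl) = trans (cong τ τ-v′) τ-v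
        helper (no a)     (no b)     = trans (cong τ (τ-fixed a b)) (τ-fixed a b)

      τ-injective : ∀ {x y} → τ x ≡ τ y → x ≡ y
      τ-injective e = trans (sym (τ-involutive _)) (trans (cong τ e) (τ-involutive _))

      τ-at : ∀ {x y z} → τ x ≡ y → τ y ≡ z → x ≡ z
      τ-at refl refl = sym (τ-involutive _)

      adjacent : ∀ {x y} → edges M (τ x) (τ y) → x ~ y
      adjacent {x} {y} m = helper (x ≟ v) (x ≟ v′) (y ≟ v) (y ≟ v′)
        where
        at-v : ∀ {x y} → edges M (τ x) (τ y) → x ≡ v → x ~ y
        at-v {y = y} m refl = subst (v ~_)
          (sym (τ-at (disjoint M (subst (λ z → edges M z (τ y)) τ-v m) (symmetric M u′v′))
                     (τ-fixed u′≢v u′≢v′)))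
          (~-sym u′~v)
        at-v′ : ∀ {x y} → edges M (τ x) (τ y) → x ≡ v′ → x ~ y
        at-v′ {y = y} m refl = subst (v′ ~_)
          (sym (τ-at (disjoint M (subst (λ z → edges M z (τ y)) τ-v′ m) (symmetric M uv))
                     (τ-fixed u≢v u≢v′)))
          (~-sym u~v′)
        helper : Dec (x ≡ v) → Dec (x ≡ v′) → Dec (y ≡ v) → Dec (y ≡ v′) → x ~ y
        helper (yes e) _ _ _ = at-v m e
        helper _ (yes e) _ _ = at-v′ m e
        helper _ _ (yes e) _ = ~-sym (at-v (symmetric M m) e)
        helper _ _ _ (yes e) = ~-sym (at-v′ (symmetric M m) e)
        helper (no a) (no b) (no c) (no d) =
          edges⊆E M (subst₂ (edges M) (τ-fixed a b) (τ-fixed c d) m)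

    -- The switched matching is the image of M under the transposition of v and v′.
    switched : PM
    switched = record
      { edges     = λ x y → edges M (τ x) (τ y)
      ; symmetric = symmetric M
      ; edges⊆E   = adjacent
      ; disjoint  = λ m m′ → τ-injective (disjoint M m m′)
      ; covering  = λ x → τ (mate M (τ x)) ,
          subst (edges M (τ x)) (sym (τ-involutive _)) (mate-edge M (τ x))
      }

    switched-new₁ : edges switched u′ v
    switched-new₁ = subst₂ (edges M) (sym (τ-fixed u′≢v u′≢v′)) (sym τ-v) u′v′

    switched-new₂ : edges switched u v′
    switched-new₂ = subst₂ (edges M) (sym (τ-fixed u≢v u≢v′)) (sym τ-v′) uv

    switched-kept : ∀ {x y} → edges M x y → ¬ (⟦ u , v ⟧ ∪ ⟦ u′ , v′ ⟧) x y → edges switched x y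
    switched-kept {x} {y} m ∉ = subst₂ (edges M) (sym (τ-fixed x≢v x≢v′)) (sym (τ-fixed y≢v y≢v′)) m
      where
      x≢v : x ≢ v
      x≢v refl = ∉ (inj₁ (inj₂ (refl , disjoint M m (symmetric M uv))))
      x≢v′ : x ≢ v′
      x≢v′ refl = ∉ (inj₂ (inj₂ (refl , disjoint M m (symmetric M u′v′))))
      y≢v : y ≢ v
      y≢v refl = ∉ (inj₁ (inj₁ (disjointˡ M m uv , refl)))
      y≢v′ : y ≢ v′
      y≢v′ refl = ∉ (inj₂ (inj₁ (disjointˡ M m u′v′ , refl)))

    switched-switch : Switch G M switched
    switched-switch = switch-intro M switched uv u′v′ u≢u′ switched-new₁ switched-new₂ switched-kept

    -- Mates change only at the four corners, so no agreement is lost when the corners disagree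
    -- beforehand.
    agree-switched : ∀ Y → (∀ {x y} → (⟦ u , v ⟧ ∪ ⟦ u′ , v′ ⟧) x y → ¬ Agree M Y x) →
      ∀ {x} → Agree M Y x → Agree switched Y x
    agree-switched Y differs {x} a =
      trans (sym (agree-intro M switched (mate-edge M x) (switched-kept (mate-edge M x) λ e → differs e a))) a

  -- The distance of two matchings and the induction step

  module Distance (vertices : List V) (complete : ∀ v → v ∈ vertices) where

    distance : PM → PM → ℕ
    distance X Y = length (filter (¬? ∘ agree? X Y) vertices)

    distance-mono : ∀ X Y X′ Y′ → (∀ {u} → Agree X Y u → Agree X′ Y′ u) →
      distance X′ Y′ ≤ distance X Y
    distance-mono X Y X′ Y′ f =
      count-mono (¬? ∘ agree? X′ Y′) (¬? ∘ agree? X Y) (λ ¬a a → ¬a (f a)) vertices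

    distance-mono-< : ∀ X Y X′ Y′ → (∀ {u} → Agree X Y u → Agree X′ Y′ u) →
      ∀ {w} → ¬ Agree X Y w → Agree X′ Y′ w → distance X′ Y′ < distance X Y
    distance-mono-< X Y X′ Y′ f {w} ¬a a =
      count-mono-< (¬? ∘ agree? X′ Y′) (¬? ∘ agree? X Y) (λ ¬a a → ¬a (f a))
        (complete w) (λ ¬a → ¬a a) ¬a

    distance-sym : ∀ X Y → distance X Y ≡ distance Y X
    distance-sym X Y = ≤-antisym (distance-mono Y X X Y sym) (distance-mono X Y Y X sym)

    -- The induction hypothesis is part of the predicate, bounded by the distance of the pair
    -- itself. This lets a step be mirrored or preceded by a switch before it is known how it
    -- descends.
    Step : PM → PM → Set₁
    Step X Y = (∀ {X′ Y′} → distance X′ Y′ < distance X Y → Reach X′ Y′) → Reach X Y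

    step-sym : ∀ {X Y} → Step X Y → Step Y X
    step-sym {X} {Y} step ih = reach-sym (step λ lt → ih (subst (_ <_) (distance-sym X Y) lt))

    step-between : ∀ {X Y} Z → distance X Z < distance X Y → distance Z Y < distance X Y → Step X Y
    step-between Z XZ<XY ZY<XY ih = reach-trans {N = Z} (ih XZ<XY) (ih ZY<XY)

    -- No descent is required of the switch: as the distance does not grow, the hypothesis available
    -- at `X` covers everything that is needed at `X′`.
    step-switch : ∀ {X Y} X′ → Switch G X X′ → (∀ {u} → Agree X Y u → Agree X′ Y u) →
      Step X′ Y → Step X Y
    step-switch {X} {Y} X′ s f step ih =
      reach-trans (reach {target = X′} (s ◅ ε) (id , id))
        (step λ lt → ih (<-≤-trans lt (distance-mono X Y X′ Y f)))

    -- `W` stands for the vertices of an alternating segment whose ends are joined by the chord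
    -- `p q`. `X` matches `W` to itself, `Y` matches `W` without the ends to itself, and the chord
    -- takes care of the ends.
    module _ (X Y : PM) {W : Pred V 0ℓ} (W? : Decidable W)
             (X-closed : ∀ {u v} → edges X u v → W u → W v)
             {p q : V} (p~q : p ~ q) (Wp : W p) (Wq : W q)
             (Y-closed : ∀ {u v} → edges Y u v →
                         W u × u ≢ p × u ≢ q → W v × v ≢ p × v ≢ q) where
      private
        p≢q : p ≢ q
        p≢q refl = loopless p~q

        Inner : Pred V 0ℓ
        Inner u = W u × u ≢ p × u ≢ q

        data Spliced (u v : V) : Set where
          chord : ⟦ p , q ⟧ u v → Spliced u v
          inner : Inner u → edges Y u v → Spliced u v
          outer : ¬ W u → edges X u v → Spliced u v

        chord-W : ∀ {u v} → ⟦ p , q ⟧ u v → W u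
        chord-W (inj₁ (refl , _)) = Wp
        chord-W (inj₂ (refl , _)) = Wq

        chord-¬inner : ∀ {u v} → ⟦ p , q ⟧ u v → ¬ Inner u
        chord-¬inner (inj₁ (e , _)) (_ , ≢p , _) = ≢p e
        chord-¬inner (inj₂ (e , _)) (_ , _ , ≢q) = ≢q e

        spliced-disjoint : ∀ {u v w} → Spliced u v → Spliced u w → v ≡ w
        spliced-disjoint (chord (inj₁ (_ , refl))) (chord (inj₁ (_ , refl))) = refl
        spliced-disjoint (chord (inj₁ (refl , _))) (chord (inj₂ (e , _))) = contradiction e p≢q
        spliced-disjoint (chord (inj₂ (refl , _))) (chord (inj₁ (e , _))) = contradiction (sym e) p≢q
        spliced-disjoint (chord (inj₂ (_ , refl))) (chord (inj₂ (_ , refl))) = refl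
        spliced-disjoint (chord c) (inner i _) = contradiction i (chord-¬inner c)
        spliced-disjoint (chord c) (outer o _) = contradiction (chord-W c) o
        spliced-disjoint (inner i _) (chord c) = contradiction i (chord-¬inner c)
        spliced-disjoint (inner _ e) (inner _ e′) = disjoint Y e e′
        spliced-disjoint (inner (w , _) _) (outer o _) = contradiction w o
        spliced-disjoint (outer o _) (chord c) = contradiction (chord-W c) o
        spliced-disjoint (outer o _) (inner (w , _) _) = contradiction w o
        spliced-disjoint (outer _ e) (outer _ e′) = disjoint X e e′

        spliced-symmetric : ∀ {u v} → Spliced u v → Spliced v u
        spliced-symmetric (chord (inj₁ (a , b))) = chord (inj₂ (b , a))
        spliced-symmetric (chord (inj₂ (a , b))) = chord (inj₁ (b , a))
        spliced-symmetric (inner i e) = inner (Y-closed e i) (symmetric Y e)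
        spliced-symmetric (outer o e) = outer (o ∘ X-closed (symmetric X e)) (symmetric X e)

        spliced-edge : ∀ {u v} → Spliced u v → u ~ v
        spliced-edge (chord (inj₁ (refl , refl))) = p~q
        spliced-edge (chord (inj₂ (refl , refl))) = ~-sym p~q
        spliced-edge (inner _ e) = edges⊆E Y e
        spliced-edge (outer _ e) = edges⊆E X e

        spliced-covering : ∀ u → ∃ (Spliced u)
        spliced-covering u with u ≟ p | u ≟ q | W? u
        ... | yes e | _     | _     = q , chord (inj₁ (e , refl))
        ... | no _  | yes e | _     = p , chord (inj₂ (e , refl))
        ... | no ≢p | no ≢q | yes w = mate Y u , inner (w , ≢p , ≢q) (mate-edge Y u)
        ... | no _  | no _  | no ¬w = mate X u , outer ¬w (mate-edge X u)

        spliced : PM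
        spliced = record
          { edges     = Spliced
          ; symmetric = spliced-symmetric
          ; edges⊆E   = spliced-edge
          ; disjoint  = spliced-disjoint
          ; covering  = spliced-covering
          }

      -- The matching with edge p q that agrees with Y elsewhere on W and with X
      -- outside W lies strictly between X and Y.
      step-splice : (∀ {u} → W u → ¬ Agree X Y u) →
        ∀ {i} → W i × i ≢ p × i ≢ q → ∀ {o} → ¬ W o → ¬ Agree X Y o → Step X Y
      step-splice W-differs {i} inn@(Wi , _) ¬Wo o-differs = step-between spliced
        -- Strictness comes from `o`, where the spliced matching follows `X`, and in the second
        -- inequality from `i`, where it follows `Y`.
        (distance-mono-< X Y X spliced (λ {u} a → agree-outer (λ w → W-differs w a)) o-differs (agree-outer ¬Wo))
        (distance-mono-< X Y spliced Y (λ {u} a → trans (sym (agree-outer (λ w → W-differs w a))) a)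
          (W-differs Wi) (agree-intro spliced Y (inner inn (mate-edge Y i)) (mate-edge Y i)))
        where
        agree-outer : ∀ {u} → ¬ W u → Agree X spliced u
        agree-outer {u} ¬w = agree-intro X spliced (mate-edge X u) (outer ¬w (mate-edge X u))

-- Parity and alternation

0≢1 : 0ℙ ≢ 1ℙ
0≢1 ()

parity-suc : ∀ n → parity (suc n) ≡ parity n ⁻¹
parity-suc zero          = refl
parity-suc (suc zero)    = refl
parity-suc (suc (suc n)) = parity-suc n

parity-pred : ∀ n {p} → parity (suc n) ≡ p → parity n ≡ p ⁻¹
parity-pred n refl = sym (trans (cong _⁻¹ (parity-suc n)) (ℙ.⁻¹-involutive _))

parity-double : ∀ n → parity (n + n) ≡ 0ℙ
parity-double n = trans (ℙ.+-homo-+ n n) (ℙ.p+p≡0ℙ (parity n))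

p+q≡0⇒p≡q : ∀ {p q} → p ℙ.+ q ≡ 0ℙ → p ≡ q
p+q≡0⇒p≡q {0ℙ} {0ℙ} _ = refl
p+q≡0⇒p≡q {1ℙ} {1ℙ} _ = refl

even-sum : ∀ m n → parity (m + n) ≡ 0ℙ → parity m ≡ parity n
even-sum m n e = p+q≡0⇒p≡q (trans (sym (ℙ.+-homo-+ m n)) e)

parity-∸ : ∀ {p q} → p ≤ q → parity p ≢ parity q → parity (q ∸ p) ≡ 1ℙ
parity-∸ {p} {q} p≤q ≢ with parity (q ∸ p) in eq
... | 1ℙ = refl
... | 0ℙ = contradiction (sym (begin
  parity q                       ≡⟨ cong parity (m∸n+n≡m p≤q) ⟨
  parity (q ∸ p + p)             ≡⟨ ℙ.+-homo-+ (q ∸ p) p ⟩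
  parity (q ∸ p) ℙ.+ parity p    ≡⟨ cong (ℙ._+ parity p) eq ⟩
  parity p                       ∎)) ≢
  where open ≡-Reasoning

-- The recursion exchanges the two values, so moving the start of a path by one definitionally swaps
-- the roles of the two matchings.
alternate : ∀ {a} {A : Set a} → A → A → ℕ → A
alternate x y zero    = x
alternate x y (suc n) = alternate y x n

module _ {a} {A : Set a} where

  alternate-even : ∀ {x y : A} n → parity n ≡ 0ℙ → alternate x y n ≡ x
  alternate-even zero          _  = refl
  alternate-even (suc (suc n)) eq = alternate-even n eq

  alternate-odd : ∀ {x y : A} n → parity n ≡ 1ℙ → alternate x y n ≡ y
  alternate-odd (suc zero)    _  = refl
  alternate-odd (suc (suc n)) eq = alternate-odd n eq

  alternate-cong : ∀ {x y : A} m n → parity m ≡ parity n → alternate x y m ≡ alternate x y n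
  alternate-cong m n same with parity m in eq
  ... | 0ℙ = trans (alternate-even m eq) (sym (alternate-even n (sym same)))
  ... | 1ℙ = trans (alternate-odd m eq) (sym (alternate-odd n (sym same)))

  alternate-+ : ∀ {x y : A} m n →
    alternate x y (m + n) ≡ alternate (alternate x y m) (alternate y x m) n
  alternate-+ zero    n = refl
  alternate-+ (suc m) n = alternate-+ m n

-- Odd chords and crossed even switches on alternating paths

Nextℕ : ℕ → Rel ℕ 0ℓ
Nextℕ m i j = j ≡ suc i ⊎ (suc i ≡ m × j ≡ 0)

module AlternatingPaths {V : Set} (_≟_ : DecidableEquality V) (G : Graph V)
                        (vertices : List V) (complete : ∀ v → v ∈ vertices) where
  open Graph G using (_~_) renaming (symmetric to ~-sym)
  open Matchings _≟_ G
  open Distance vertices complete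

  step-alternate : ∀ {X Y} n → Step (alternate X Y n) (alternate Y X n) → Step X Y
  step-alternate zero    s = s
  step-alternate (suc n) s = step-sym (step-alternate n s)

  agree-alternate : ∀ X Y n {u} → Agree X Y u → Agree (alternate X Y n) (alternate Y X n) u
  agree-alternate X Y zero    a = a
  agree-alternate X Y (suc n) a = agree-alternate Y X n (sym a)

  agree-unalternate : ∀ X Y n {u} → Agree (alternate X Y n) (alternate Y X n) u → Agree X Y u
  agree-unalternate X Y zero    a = a
  agree-unalternate X Y (suc n) a = sym (agree-unalternate Y X n a)

  -- A path rather than a cycle, because this form survives dropping an initial segment and
  -- reversing an inner one. Positions are plain naturals for the sake of the arithmetic; values of
  -- `c` from `m` on are arbitrary.
  record Path (X Y : PM) (m : ℕ) (c : ℕ → V) : Set where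
    field
      edge      : ∀ {t} → suc t < m → edges (alternate X Y t) (c t) (c (suc t))
      injective : ∀ {s t} → s < m → t < m → c s ≡ c t → s ≡ t

  module _ {X Y m c} (path : Path X Y m c) where
    open Path path

    edge-even : ∀ {t} → parity t ≡ 0ℙ → suc t < m → edges X (c t) (c (suc t))
    edge-even {t} eq lt = subst (λ M → edges M (c t) (c (suc t))) (alternate-even t eq) (edge lt)

    edge-odd : ∀ {t} → parity t ≡ 1ℙ → suc t < m → edges Y (c t) (c (suc t))
    edge-odd {t} eq lt = subst (λ M → edges M (c t) (c (suc t))) (alternate-odd t eq) (edge lt)

    private
      no-return : ∀ {t} → suc (suc t) < m → c t ≢ c (suc (suc t))
      no-return {t} lt e = m+1+n≢n 1 (sym (injective (<-trans (m<n⇒m<1+n ≤-refl) lt) lt e))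

      differs-before : ∀ {t} → suc (suc t) < m → ¬ Agree X Y (c t)
      differs-before {t} lt a = no-return lt
        (disjoint (alternate Y X t)
          (symmetric (alternate Y X t)
            (agree-edge (alternate X Y t) (alternate Y X t) (agree-alternate X Y t a) (edge (<-trans ≤-refl lt))))
          (edge lt))

      differs-after : ∀ {t} → suc (suc t) < m → ¬ Agree X Y (c (suc (suc t)))
      differs-after {t} lt a = no-return lt
        (disjointˡ (alternate X Y t)
          (edge (<-trans ≤-refl lt))
          (agree-edge (alternate Y X t) (alternate X Y t) (sym (agree-alternate X Y t a))
            (symmetric (alternate Y X t) (edge lt))))

    -- Agreement at one end of two consecutive path edges would put both into one matching and
    -- identify their outer ends. Positions 0 and 1 look ahead, all others back; position 1 needs
    -- `4 ≤ m`.
    path-differs : 4 ≤ m → ∀ {t} → t < m → ¬ Agree X Y (c t)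
    path-differs 4≤m {zero}        _  = differs-before (≤-trans (s≤s (s≤s (s≤s z≤n))) 4≤m)
    path-differs 4≤m {suc zero}    _  = differs-before 4≤m
    path-differs 4≤m {suc (suc t)} lt = differs-after lt

    path-shift : ∀ n → Path (alternate X Y n) (alternate Y X n) (m ∸ n) (c ∘ (n +_))
    path-shift n = record
      { edge      = λ {t} lt → subst₂ (λ M s → edges M (c (n + t)) (c s)) (alternate-+ n t) (sym (+-suc n t))
                      (edge (subst (_< m) (+-suc n t) (bound lt)))
      ; injective = λ s< t< e → +-cancelˡ-≡ n _ _ (injective (bound s<) (bound t<) e)
      }
      where
      bound : ∀ {t} → t < m ∸ n → n + t < m
      bound {t} lt = subst (_≤ m) (+-suc n t)
        (≤-trans (+-monoʳ-≤ n lt) (≤-reflexive (m+[n∸m]≡n (<⇒≤ n<m))))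
        where
        n<m : n < m
        n<m = m∸n≢0⇒n<m {m} {n} (λ e → n≮0 (subst (t <_) e lt))

  module _ {X Y m c} (path : Path X Y m c) {ℓ} (ℓ<m : ℓ < m) (odd : parity ℓ ≡ 1ℙ) (1<ℓ : 1 < ℓ) where
    open Path path

    private
      On : Pred V 0ℓ
      On u = ∃ λ t → t < suc ℓ × c t ≡ u

      on? : Decidable On
      on? u = anyUpTo? (λ t → c t ≟ u) (suc ℓ)

      below : ∀ {t} → t < suc ℓ → t < m
      below t≤ℓ = <-≤-trans t≤ℓ ℓ<m

      not-last : ∀ {t} → t < suc ℓ → t ≢ ℓ → suc t < suc ℓ
      not-last (s≤s t≤ℓ) t≢ℓ = s≤s (≤∧≢⇒< t≤ℓ t≢ℓ)

      even≢ℓ : ∀ {t} → parity t ≡ 0ℙ → t ≢ ℓ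
      even≢ℓ even refl = 0≢1 (trans (sym even) odd)

      X-closed : ∀ {u v} → edges X u v → On u → On v
      X-closed uv (t , t≤ℓ , refl) with parity t in eq
      X-closed uv (t , t≤ℓ , refl) | 0ℙ =
        suc t , t<ℓ , disjoint X (edge-even path eq (below t<ℓ)) uv
        where t<ℓ = not-last t≤ℓ (even≢ℓ eq)
      X-closed uv (suc s , t≤ℓ , refl) | 1ℙ =
        s , <-trans ≤-refl t≤ℓ , disjoint X (symmetric X (edge-even path (parity-pred s eq) (below t≤ℓ))) uv

      Y-closed : ∀ {u v} → edges Y u v → On u × u ≢ c 0 × u ≢ c ℓ → On v × v ≢ c 0 × v ≢ c ℓ
      Y-closed uv ((zero , _ , refl) , ≢c0 , _) = contradiction refl ≢c0
      Y-closed uv ((suc s , t≤ℓ , refl) , _ , ≢cℓ) with parity (suc s) in eq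
      ... | 0ℙ with refl ← disjoint Y (symmetric Y (edge-odd path (parity-pred s eq) (below t≤ℓ))) uv =
        (s , s<1+ℓ , refl) ,
        (λ e → case injective (below s<1+ℓ) (<-≤-trans (s≤s z≤n) ℓ<m) e of λ { refl → 0≢1 (sym eq) }) ,
        (λ e → <-irrefl (injective (below s<1+ℓ) ℓ<m e) (s≤s⁻¹ t≤ℓ))
        where s<1+ℓ = <-trans ≤-refl t≤ℓ
      ... | 1ℙ with t<ℓ ← not-last t≤ℓ (λ { refl → ≢cℓ refl })
               with refl ← disjoint Y (edge-odd path eq (below t<ℓ)) uv =
        (suc (suc s) , t<ℓ , refl) ,
        (λ e → case injective (below t<ℓ) (<-≤-trans (s≤s z≤n) ℓ<m) e of λ ()) ,
        (λ e → even≢ℓ (parity-pred (suc (suc s)) eq) (injective (below t<ℓ) ℓ<m e))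

      4≤m : 4 ≤ m
      4≤m = ≤-trans (s≤s (≤∧≢⇒< 1<ℓ (λ { refl → 0≢1 odd }))) ℓ<m

    -- X matches the path c 0, …, c ℓ to itself, and Y its interior.
    step-chord-from-0 : c 0 ~ c ℓ → ∀ {o} → (∀ {t} → t < suc ℓ → c t ≢ o) → ¬ Agree X Y o → Step X Y
    step-chord-from-0 c0~cℓ off o-differs =
      step-splice X Y on? X-closed c0~cℓ (0 , s≤s z≤n , refl) (ℓ , ≤-refl , refl) Y-closed
        (λ { (t , t≤ℓ , refl) → path-differs path 4≤m (below t≤ℓ) })
        {c 1} ((1 , s≤s (<⇒≤ 1<ℓ) , refl) ,
          (λ e → case injective 1<m (<⇒≤ 1<m) e of λ ()) ,
          (λ e → <-irrefl (injective 1<m ℓ<m e) 1<ℓ))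
        (λ { (t , t≤ℓ , e) → off t≤ℓ e }) o-differs
      where
      1<m : 1 < m
      1<m = <-trans 1<ℓ ℓ<m

  -- Dropping the first `p` positions moves the chord to position 0; for odd `p` this exchanges the
  -- matchings, which `step-alternate` undoes. That `q` does not follow `p` makes the segment longer
  -- than one edge; that `p` does not follow `q` cyclically leaves a path vertex outside it.
  step-chord-< : ∀ {X Y m c} → Path X Y m c → ∀ {p q} → p < q → q < m → parity p ≢ parity q →
    ¬ Nextℕ m p q → ¬ Nextℕ m q p → c p ~ c q → Step X Y
  step-chord-< {X} {Y} {m} {c} path {p} {q} p<q q<m ≢parity ¬pq ¬qp cp~cq =
    step-alternate p (step-chord-from-0 (path-shift path p) ℓ<m∸p odd 1<ℓ
      (subst₂ (λ s t → c s ~ c t) (sym (+-identityʳ p)) (sym p+ℓ≡q) cp~cq)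
      (proj₁ (proj₂ outside)) (proj₂ (proj₂ outside) ∘ agree-unalternate X Y p))
    where
    open Path path
    ℓ = q ∸ p
    p+ℓ≡q : p + ℓ ≡ q
    p+ℓ≡q = m+[n∸m]≡n (<⇒≤ p<q)
    ℓ<m∸p : ℓ < m ∸ p
    ℓ<m∸p = ∸-monoˡ-< q<m (<⇒≤ p<q)
    odd : parity ℓ ≡ 1ℙ
    odd = parity-∸ (<⇒≤ p<q) ≢parity
    ℓ≢1 : ℓ ≢ 1
    ℓ≢1 e = ¬pq (inj₁ (trans (sym p+ℓ≡q) (trans (cong (p +_) e) (+-comm p 1))))
    1<ℓ : 1 < ℓ
    1<ℓ = ≤∧≢⇒< (m<n⇒0<n∸m p<q) (ℓ≢1 ∘ sym)
    4≤m : 4 ≤ m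
    4≤m = ≤-trans (s≤s (≤-trans (≤∧≢⇒< 1<ℓ (λ e → 0≢1 (trans (cong parity e) odd))) (m∸n≤m q p))) q<m
    within : ∀ {t} → t < suc ℓ → p + t ≤ q
    within (s≤s t≤ℓ) = ≤-trans (+-monoʳ-≤ p t≤ℓ) (≤-reflexive p+ℓ≡q)
    outside : ∃ λ o → (∀ {t} → t < suc ℓ → c (p + t) ≢ o) × ¬ Agree X Y o
    -- A segment starting at 0 cannot reach the last position, so its successor is outside;
    -- otherwise position 0 is.
    outside with p ℕ.≟ 0
    ... | yes refl = c (suc q) ,
      (λ t≤ℓ e → <-irrefl (injective (≤-<-trans (within t≤ℓ) q<m) 1+q<m e) (s≤s (within t≤ℓ))) ,
      path-differs path 4≤m 1+q<m
      where 1+q<m = ≤∧≢⇒< q<m (λ e → ¬qp (inj₂ (e , refl)))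
    ... | no p≢0 = c 0 ,
      (λ {t} t≤ℓ e → p≢0 (m+n≡0⇒m≡0 p (injective (≤-<-trans (within t≤ℓ) q<m) 0<m e))) ,
      path-differs path 4≤m 0<m
      where 0<m = <-≤-trans (s≤s z≤n) 4≤m

  step-chord : ∀ {X Y m c} → Path X Y m c → ∀ {p q} → p < m → q < m → parity p ≢ parity q →
    ¬ Nextℕ m p q → ¬ Nextℕ m q p → c p ~ c q → Step X Y
  step-chord path {p} {q} p<m q<m ≢parity ¬pq ¬qp p~q with <-cmp p q
  ... | tri< p<q _ _ = step-chord-< path p<q q<m ≢parity ¬pq ¬qp p~q
  ... | tri≈ _ refl _ = contradiction refl ≢parity
  ... | tri> _ _ q<p = step-chord-< path q<p p<m (≢parity ∘ sym) ¬qp ¬pq (~-sym p~q)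

  module _ {X Y m c} (path : Path X Y m c) (4≤m : 4 ≤ m) {a b}
           (a-even : parity a ≡ 0ℙ) (b-even : parity b ≡ 0ℙ) (a<b : a < b) (1+b<m : suc b < m)
           (ca~cb : c a ~ c b) (ca′~cb′ : c (suc a) ~ c (suc b)) where
    open Path path

    private
      b<m : b < m
      b<m = <-trans ≤-refl 1+b<m
      1+a<m : suc a < m
      1+a<m = ≤-<-trans a<b b<m
      a<m : a < m
      a<m = <-trans ≤-refl 1+a<m

      aa′ : edges X (c a) (c (suc a))
      aa′ = edge-even path a-even 1+a<m

      b′b : edges X (c (suc b)) (c b)
      b′b = symmetric X (edge-even path b-even 1+b<m)

      a≢b′ : c a ≢ c (suc b)
      a≢b′ e = <-irrefl (injective a<m 1+b<m e) (<-trans a<b ≤-refl)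

      a≢b : c a ≢ c b
      a≢b e = <-irrefl (injective a<m b<m e) a<b

      -- The second edge is taken backwards, from `suc b` to `b`, so that the exchange creates the
      -- two even chords instead of the diagonals.
      open Switched X aa′ b′b a≢b′ a≢b (~-sym ca′~cb′) ca~cb renaming (switched to X′)

      kept : ∀ {t} → suc t < m → t ≢ a → t ≢ b → edges (alternate X′ Y t) (c t) (c (suc t))
      kept {t} lt t≢a t≢b with parity t in eq
      ... | 1ℙ = subst (λ M → edges M (c t) (c (suc t))) (sym (alternate-odd t eq)) (edge-odd path eq lt)
      ... | 0ℙ = subst (λ M → edges M (c t) (c (suc t))) (sym (alternate-even t eq))
                   (switched-kept (edge-even path eq lt) ∉)
        where
        t<m = <-trans ≤-refl lt
        ∉ : ¬ (⟦ c a , c (suc a) ⟧ ∪ ⟦ c (suc b) , c b ⟧) (c t) (c (suc t))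
        ∉ (inj₁ (inj₁ (e , _))) = t≢a (injective t<m a<m e)
        ∉ (inj₁ (inj₂ (e , e′))) = m+1+n≢n 1 (trans (cong suc (sym (injective t<m 1+a<m e))) (injective lt a<m e′))
        ∉ (inj₂ (inj₁ (e , e′))) = m+1+n≢n 1 (trans (cong suc (sym (injective t<m 1+b<m e))) (injective lt b<m e′))
        ∉ (inj₂ (inj₂ (e , _))) = t≢b (injective t<m b<m e)

      corner-differs : ∀ {u v} → (⟦ c a , c (suc a) ⟧ ∪ ⟦ c (suc b) , c b ⟧) u v → ¬ Agree X Y u
      corner-differs (inj₁ (inj₁ (refl , _))) = path-differs path 4≤m a<m
      corner-differs (inj₁ (inj₂ (refl , _))) = path-differs path 4≤m 1+a<m
      corner-differs (inj₂ (inj₁ (refl , _))) = path-differs path 4≤m 1+b<m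
      corner-differs (inj₂ (inj₂ (refl , _))) = path-differs path 4≤m b<m

      -- The sum of the first position `suc a` and the last position `b` of the segment to be
      -- reversed, so `t ↦ s ∸ t` reflects that segment. It is odd.
      s : ℕ
      s = suc (a + b)

      a+b-even : parity (a + b) ≡ 0ℙ
      a+b-even = trans (ℙ.+-homo-+ a b) (cong₂ ℙ._+_ a-even b-even)

      data Position (t : ℕ) : Set where
        before  : t ≤ a → Position t
        between : a < t → t ≤ b → Position t
        after   : b < t → Position t

      position : ∀ t → Position t
      position t with t ℕ.≤? a | t ℕ.≤? b
      ... | yes t≤a | _       = before t≤a
      ... | no  t≰a | yes t≤b = between (≰⇒> t≰a) t≤b
      ... | no  _   | no  t≰b = after (≰⇒> t≰b)

      ρ : ℕ → ℕ
      ρ t with position t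
      ... | before _    = t
      ... | between _ _ = s ∸ t
      ... | after _     = t

      ρ-before : ∀ {t} → t ≤ a → ρ t ≡ t
      ρ-before {t} t≤a with position t
      ... | before _      = refl
      ... | between a<t _ = contradiction t≤a (<⇒≱ a<t)
      ... | after _       = refl

      ρ-between : ∀ {t} → a < t → t ≤ b → ρ t ≡ s ∸ t
      ρ-between {t} a<t t≤b with position t
      ... | before t≤a  = contradiction t≤a (<⇒≱ a<t)
      ... | between _ _ = refl
      ... | after b<t   = contradiction t≤b (<⇒≱ b<t)

      ρ-after : ∀ {t} → b < t → ρ t ≡ t
      ρ-after {t} b<t with position t
      ... | before _      = refl
      ... | between _ t≤b = contradiction t≤b (<⇒≱ b<t)
      ... | after _       = refl

      b≤s : b ≤ s
      b≤s = m≤n+m b (suc a)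

      s∸a′ : s ∸ suc a ≡ b
      s∸a′ = m+n∸m≡n a b

      s∸b : s ∸ b ≡ suc a
      s∸b = m+n∸n≡m (suc a) b

      a<s∸ : ∀ {t} → t ≤ b → a < s ∸ t
      a<s∸ {t} t≤b = subst (_≤ s ∸ t) s∸b (∸-monoʳ-≤ s t≤b)

      s∸≤b : ∀ {t} → a < t → s ∸ t ≤ b
      s∸≤b {t} a<t = subst (s ∸ t ≤_) s∸a′ (∸-monoʳ-≤ s a<t)

      ρ-involutive : ∀ t → ρ (ρ t) ≡ t
      ρ-involutive t with position t
      ... | before t≤a      = ρ-before t≤a
      ... | between a<t t≤b = trans (ρ-between (a<s∸ t≤b) (s∸≤b a<t)) (m∸[m∸n]≡n (≤-trans t≤b b≤s))
      ... | after b<t       = ρ-after b<t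

      ρ<m : ∀ {t} → t < m → ρ t < m
      ρ<m {t} t<m with position t
      ... | before _      = t<m
      ... | between a<t _ = ≤-<-trans (s∸≤b a<t) b<m
      ... | after _       = t<m

      at : ∀ {M i i′ j j′} → i ≡ i′ → j ≡ j′ → edges M (c i) (c j) → edges M (c i′) (c j′)
      at refl refl e = e

      EdgeAt : PM → ℕ × ℕ → Set
      EdgeAt M (i , j) = edges M (c i) (c j)

      -- The new chords join the reversed segment to the rest, at `a` and at `b`. Inside the
      -- segment, the edge at `t` is the old edge at `r = a + b ∸ t` read backwards; since `a + b`
      -- is even, `r` has the parity of `t` and the edge stays in the matching expected at `t`.
      ρ-edge : ∀ {t} → suc t < m → edges (alternate X′ Y t) (c (ρ t)) (c (ρ (suc t)))
      ρ-edge {t} lt = helper (position t)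
        where
        helper : Position t → edges (alternate X′ Y t) (c (ρ t)) (c (ρ (suc t)))
        helper (before t≤a) with t ℕ.≟ a
        ... | yes refl = subst₂ EdgeAt (sym (alternate-even t a-even))
                           (sym (cong₂ _,_ (ρ-before ≤-refl) (trans (ρ-between ≤-refl a<b) s∸a′)))
                           switched-new₂
        ... | no t≢a = at {alternate X′ Y t} (sym (ρ-before t≤a)) (sym (ρ-before t<a))
                         (kept lt t≢a (<⇒≢ (<-trans t<a a<b)))
          where t<a = ≤∧≢⇒< t≤a t≢a
        helper (between a<t t≤b) with t ℕ.≟ b
        ... | yes refl = subst₂ EdgeAt (sym (alternate-even t b-even))
                           (sym (cong₂ _,_ (trans (ρ-between a<b ≤-refl) s∸b) (ρ-after ≤-refl)))
                           (symmetric X′ switched-new₁)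
        ... | no t≢b = at {alternate X′ Y t} (sym (trans (ρ-between a<t t≤b) (+-∸-assoc 1 t≤a+b)))
                         (sym (ρ-between (<-trans a<t ≤-refl) t<b))
                         (symmetric (alternate X′ Y t)
                           (subst (λ M → edges M (c r) (c (suc r))) r-parity
                             (kept (≤-<-trans 1+r≤b b<m) r≢a r≢b)))
          where
          t<b = ≤∧≢⇒< t≤b t≢b
          t≤a+b : t ≤ a + b
          t≤a+b = ≤-trans t≤b (m≤n+m b a)
          r = a + b ∸ t
          1+r≤b : suc r ≤ b
          1+r≤b = ≤-trans (≤-reflexive (sym (+-∸-assoc 1 t≤a+b))) (s∸≤b a<t)
          r+t≡a+b : r + t ≡ a + b
          r+t≡a+b = m∸n+n≡m t≤a+b
          r-parity : alternate X′ Y r ≡ alternate X′ Y t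
          r-parity = alternate-cong r t (even-sum r t (trans (cong parity r+t≡a+b) a+b-even))
          r≢a : r ≢ a
          r≢a e = t≢b (+-cancelˡ-≡ a t b (trans (cong (_+ t) (sym e)) r+t≡a+b))
          r≢b : r ≢ b
          r≢b e = <-irrefl (+-cancelˡ-≡ b a t (trans (+-comm b a) (trans (sym r+t≡a+b) (cong (_+ t) e)))) a<t
        helper (after b<t) = at {alternate X′ Y t} (sym (ρ-after b<t)) (sym (ρ-after (<-trans b<t ≤-refl)))
                               (kept lt (>⇒≢ (<-trans a<b b<t)) (>⇒≢ b<t))

      -- Reversing the segment strictly between the two switched edges turns the
      -- cycle into an alternating cycle of X′ and Y.
      reversed : Path X′ Y m (c ∘ ρ)
      reversed = record
        { edge      = ρ-edge
        ; injective = λ s<m t<m e → trans (sym (ρ-involutive _))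
            (trans (cong ρ (injective (ρ<m s<m) (ρ<m t<m) e)) (ρ-involutive _))
        }

    -- Reflection changes the parity of `k` and leaves `l` alone. The two excluded pairs are the
    -- chords of the switch: they are the only chords between the segment and the rest that become
    -- edges of the reversed cycle.
    step-crossed-switch : ∀ {k l} → a < k → k ≤ b → b < l ⊎ l ≤ a → l < m → parity k ≡ parity l →
      ¬ (k ≡ b × l ≡ a) → ¬ (k ≡ suc a × l ≡ suc b) → c k ~ c l → Step X Y
    step-crossed-switch {k} {l} a<k k≤b l-outside l<m same ¬ab ¬a′b′ ck~cl =
      step-switch X′ switched-switch (agree-switched Y corner-differs)
        (step-chord reversed (≤-<-trans k′≤b b<m) l<m k′-parity (¬k′l l-outside) (¬lk′ l-outside)
          (subst₂ (λ i j → c i ~ c j) (sym ρk′) (sym (ρl l-outside)) ck~cl))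
      where
      k′ = s ∸ k
      k≤s : k ≤ s
      k≤s = ≤-trans k≤b b≤s
      a<k′ : a < k′
      a<k′ = a<s∸ k≤b
      k′≤b : k′ ≤ b
      k′≤b = s∸≤b a<k
      s∸k′ : s ∸ k′ ≡ k
      s∸k′ = m∸[m∸n]≡n k≤s
      ρk′ : ρ k′ ≡ k
      ρk′ = trans (ρ-between a<k′ k′≤b) s∸k′
      ρl : b < l ⊎ l ≤ a → ρ l ≡ l
      ρl (inj₁ b<l) = ρ-after b<l
      ρl (inj₂ l≤a) = ρ-before l≤a
      k′-parity : parity k′ ≢ parity l
      k′-parity e = 0≢1 (begin
        0ℙ                        ≡⟨ ℙ.p+p≡0ℙ (parity k) ⟨
        parity k ℙ.+ parity k     ≡⟨ cong (ℙ._+ parity k) (trans e (sym same)) ⟨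
        parity k′ ℙ.+ parity k    ≡⟨ ℙ.+-homo-+ k′ k ⟨
        parity (k′ + k)           ≡⟨ cong parity (m∸n+n≡m k≤s) ⟩
        parity s                  ≡⟨ parity-suc (a + b) ⟩
        parity (a + b) ⁻¹         ≡⟨ cong _⁻¹ a+b-even ⟩
        1ℙ                        ∎)
        where open ≡-Reasoning
      ¬k′l : b < l ⊎ l ≤ a → ¬ Nextℕ m k′ l
      ¬k′l _          (inj₂ (e , _)) = <-irrefl e (≤-<-trans (s≤s k′≤b) 1+b<m)
      ¬k′l (inj₂ l≤a) (inj₁ e)       = <-asym a<k′ (subst (_≤ a) e l≤a)
      ¬k′l (inj₁ b<l) (inj₁ e)       =
        ¬a′b′ (trans (sym s∸k′) (trans (cong (s ∸_) k′≡b) s∸b) , trans e (cong suc k′≡b))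
        where k′≡b = ≤-antisym k′≤b (s≤s⁻¹ (subst (b <_) e b<l))
      ¬lk′ : b < l ⊎ l ≤ a → ¬ Nextℕ m l k′
      ¬lk′ _          (inj₂ (_ , e)) = n≮0 (subst (a <_) e a<k′)
      ¬lk′ (inj₁ b<l) (inj₁ e)       = <-irrefl refl (<-≤-trans (<-trans b<l ≤-refl) (subst (_≤ b) e k′≤b))
      ¬lk′ (inj₂ l≤a) (inj₁ e)       =
        ¬ab (trans (sym s∸k′) (trans (cong (s ∸_) (trans e (cong suc l≡a))) s∸a′) , l≡a)
        where l≡a = ≤-antisym l≤a (s≤s⁻¹ (subst (a <_) e a<k′))

-- Parity of differences, least witnesses and paired positions

2∣-even : ∀ n → parity n ≡ 0ℙ → 2 ∣ n
2∣-even zero          _ = divides 0 refl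
2∣-even (suc (suc n)) e with divides q refl ← 2∣-even n e = divides (suc q) refl

parity-∣-∣ : ∀ m n → parity ∣ m - n ∣ ≡ parity m ℙ.+ parity n
parity-∣-∣ zero    n       = refl
parity-∣-∣ (suc m) zero    = sym (ℙ.+-identityʳ (parity (suc m)))
parity-∣-∣ (suc m) (suc n) rewrite parity-∣-∣ m n | parity-suc m | parity-suc n
  with parity m | parity n
... | 0ℙ | 0ℙ = refl
... | 0ℙ | 1ℙ = refl
... | 1ℙ | 0ℙ = refl
... | 1ℙ | 1ℙ = refl

2∤⇒parity≢ : ∀ m n → 2 ∤ ∣ m - n ∣ → parity m ≢ parity n
2∤⇒parity≢ m n 2∤ e = 2∤ (2∣-even ∣ m - n ∣
  (trans (parity-∣-∣ m n) (trans (cong (ℙ._+ parity n) e) (ℙ.p+p≡0ℙ (parity n)))))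

module _ {P : Pred ℕ 0ℓ} (P? : Decidable P) where

  Least : Set
  Least = ∃ λ m → P m × (∀ {k} → k < m → ¬ P k)

  least : ∀ {n} → P n → Least
  least {n} = <-rec (λ n → P n → Least) search n
    where
    search : ∀ n → (∀ {k} → k < n → P k → Least) → P n → Least
    search n rec p with anyUpTo? P? n
    ... | yes (k , k<n , q) = rec k<n q
    ... | no none           = n , p , λ {k} k<n q → none (k , k<n , q)

-- Definitionally the positions `fst i` and `snd i`, without their implicit graph parameter.
left right : ∀ {r} → Fin r → Fin (r * 2)
left i  = Fin.combine i Fin.zero
right i = Fin.combine i (Fin.suc Fin.zero)

toℕ-left : ∀ r (i : Fin r) → toℕ (left {r} i) ≡ toℕ i + toℕ i
toℕ-left r i = trans (toℕ-combine i (Fin.zero {1})) (trans (+-identityʳ _) (cong (toℕ i +_) (+-identityʳ _)))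

toℕ-right : ∀ r (i : Fin r) → toℕ (right {r} i) ≡ suc (toℕ (left {r} i))
toℕ-right r i = trans (toℕ-combine i (Fin.suc (Fin.zero {0})))
  (trans (+-comm _ 1) (cong suc (sym (trans (toℕ-combine i (Fin.zero {1})) (+-identityʳ _)))))

left-even : ∀ r (i : Fin r) → parity (toℕ (left {r} i)) ≡ 0ℙ
left-even r i = trans (cong parity (toℕ-left r i)) (parity-double (toℕ i))

left-mono-< : ∀ r {i j : Fin r} → i Fin.< j → toℕ (left {r} i) < toℕ (left {r} j)
left-mono-< r {i = i} {j} i<j = subst₂ _<_ (sym (toℕ-left r i)) (sym (toℕ-left r j)) (+-mono-< i<j i<j)

-- From switchable to ergodic: alternating cycles of two matchings

module Ergodicity {V : Set} (_≟_ : DecidableEquality V) (G : Graph V)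
                  (vertices : List V) (complete : ∀ v → v ∈ vertices)
                  (switchable : Switchable G) where
  open Graph G using (_~_) renaming (symmetric to ~-sym)
  open Matchings _≟_ G
  open Distance vertices complete
  open AlternatingPaths _≟_ G vertices complete

  module _ {m} (D : Cycle G m) {X Y d} (path : Path X Y m d)
           (d-vertex : ∀ i → d (toℕ i) ≡ Cycle.vertex D i) where
    open Cycle D

    step-odd-chord : ∀ {k l} → Chord D k l → parity (toℕ k) ≢ parity (toℕ l) → Step X Y
    step-odd-chord {k} {l} (k~l , ∉) ≢parity =
      step-chord path (toℕ<n k) (toℕ<n l) ≢parity
        (λ next → ∉ (k , l , next , inj₁ (refl , refl)))
        (λ next → ∉ (l , k , next , inj₂ (refl , refl)))
        (subst₂ _~_ (sym (d-vertex k)) (sym (d-vertex l)) k~l)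

  module _ r (D : Cycle G (r * 2)) {X Y d} (path : Path X Y (r * 2) d)
           (d-vertex : ∀ i → d (toℕ i) ≡ Cycle.vertex D i) (4≤m : 4 ≤ r * 2) where
    open Cycle D

    -- A crossing chord may happen to be odd; it then splits the cycle directly, and the switch is
    -- performed only for an even one.
    step-even-switch : ∀ {i j k l} → EvenSwitch {r = r} D i j → CrossingChord {r = r} D i j k l → Step X Y
    step-even-switch {i} {j} {k} {l} (i<j , fst~ , snd~) (chord , ¬fst , ¬snd , (si≤k , k≤fj) , l-outside)
      with parity (toℕ k) ℙ.≟ parity (toℕ l)
    ... | no ≢parity = step-odd-chord D path d-vertex chord ≢parity
    ... | yes same   = step-crossed-switch path 4≤m (left-even r i) (left-even r j) (left-mono-< r i<j)
      (subst (_< r * 2) (toℕ-right r j) (toℕ<n (right {r} j)))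
      (subst₂ _~_ (sym (d-vertex _)) (sym (d-vertex _)) fst~)
      (subst₂ _~_ (sym (at-right i)) (sym (at-right j)) snd~)
      (subst (_≤ toℕ k) (toℕ-right r i) si≤k) k≤fj
      ([ inj₁ ∘ subst (_≤ toℕ l) (toℕ-right r j) , inj₂ ]′ l-outside)
      (toℕ<n l) same
      (λ (a , b) → ¬fst (inj₂ (toℕ-injective a , toℕ-injective b)))
      (λ (a , b) → ¬snd (inj₁ (toℕ-injective (trans a (sym (toℕ-right r i))) ,
                               toℕ-injective (trans b (sym (toℕ-right r j))))))
      (subst₂ _~_ (sym (d-vertex k)) (sym (d-vertex l)) (proj₁ chord))
      where
      at-right : ∀ i → d (suc (toℕ (left {r} i))) ≡ vertex (right {r} i)
      at-right i = trans (cong d (sym (toℕ-right r i))) (d-vertex (right {r} i))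

  -- The two `Y` edges of the square are just what is needed to switch its two `X` edges; afterwards
  -- `c 0` has its mate in `Y`.
  step-square : ∀ {X Y c} → Path X Y 4 c → edges Y (c 3) (c 0) → Step X Y
  step-square {X} {Y} {c} path c3c0 ih =
    reach-trans {N = X′} (reach {target = X′} (switched-switch ◅ ε) (id , id))
      (ih (distance-mono-< X Y X′ Y (agree-switched Y differs) (path-differs path ≤-refl (s≤s z≤n))
        (agree-intro X′ Y switched-new₂ (symmetric Y c3c0))))
    where
    open Path path
    open Switched X (edge {0} (s≤s (s≤s z≤n))) (edge {2} ≤-refl)
      (λ e → case injective (s≤s z≤n) (s≤s (s≤s (s≤s z≤n))) e of λ ())
      (λ e → case injective (s≤s z≤n) ≤-refl e of λ ())
      (~-sym (edges⊆E Y (edge {1} (s≤s (s≤s (s≤s z≤n))))))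
      (~-sym (edges⊆E Y c3c0))
      renaming (switched to X′)
    differs : ∀ {x y} → (⟦ c 0 , c 1 ⟧ ∪ ⟦ c 2 , c 3 ⟧) x y → ¬ Agree X Y x
    differs (inj₁ (inj₁ (refl , _))) = path-differs path ≤-refl (s≤s z≤n)
    differs (inj₁ (inj₂ (refl , _))) = path-differs path ≤-refl (s≤s (s≤s z≤n))
    differs (inj₂ (inj₁ (refl , _))) = path-differs path ≤-refl (s≤s (s≤s (s≤s z≤n)))
    differs (inj₂ (inj₂ (refl , _))) = path-differs path ≤-refl ≤-refl

  module _ {X Y m c} (3≤m : 3 ≤ m) (path : Path X Y m c) {last} (1+last≡m : suc last ≡ m)
           (close : edges Y (c last) (c 0)) where
    open Path path

    closed-path-cycle : Cycle G m
    closed-path-cycle = record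
      { 3≤m       = 3≤m
      ; vertex    = c ∘ toℕ
      ; injective = λ {i} {j} e → toℕ-injective (injective (toℕ<n i) (toℕ<n j) e)
      ; adjacent  = λ { {i} {j} (inj₁ e) → subst (λ t → c (toℕ i) ~ c t) (sym e)
                          (edges⊆E (alternate X Y (toℕ i)) (edge (subst (_< m) e (toℕ<n j))))
                      ; (inj₂ (e , e′)) → subst₂ (λ s t → c s ~ c t) (suc-injective (trans 1+last≡m (sym e))) (sym e′)
                          (edges⊆E Y close) }
      }

    private
      pick : ∀ t {u v} → edges (alternate X Y t) u v → edges X u v ⊎ edges Y u v
      pick t e with parity t in eq
      ... | 0ℙ = inj₁ (subst (λ M → edges M _ _) (alternate-even t eq) e)
      ... | 1ℙ = inj₂ (subst (λ M → edges M _ _) (alternate-odd t eq) e)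

      along : ∀ {i j : Fin m} → Next i j →
        edges X (c (toℕ i)) (c (toℕ j)) ⊎ edges Y (c (toℕ i)) (c (toℕ j))
      along {i} {j} (inj₁ e) = pick (toℕ i)
        (subst (λ t → edges (alternate X Y (toℕ i)) (c (toℕ i)) (c t)) (sym e) (edge (subst (_< m) e (toℕ<n j))))
      along (inj₂ (e , e′)) = inj₂
        (subst₂ (λ s t → edges Y (c s) (c t)) (suc-injective (trans 1+last≡m (sym e))) (sym e′) close)

    closed-path-edges : ∀ {u v} → Cycle.cycleEdges closed-path-cycle u v → edges X u v ⊎ edges Y u v
    closed-path-edges (i , j , next , inj₁ (refl , refl)) = along next
    closed-path-edges (i , j , next , inj₂ (refl , refl)) =
      [ inj₁ ∘ symmetric X , inj₂ ∘ symmetric Y ]′ (along next)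

  -- Each edge lies in X or in Y, and consecutive edges cannot lie in the same matching.
  alternating : ∀ {X Y m d} → (∀ {t} → suc t < m → edges X (d t) (d (suc t)) ⊎ edges Y (d t) (d (suc t))) →
    (∀ {s t} → s < m → t < m → d s ≡ d t → s ≡ t) →
    (1 < m → edges X (d 0) (d 1)) → Path X Y m d
  alternating {X} {Y} {m} {d} in-union inj first = record { edge = λ {t} → edge t ; injective = inj }
    where
    next : ∀ M N t → suc (suc t) < m → edges M (d t) (d (suc t)) →
      edges M (d (suc t)) (d (suc (suc t))) ⊎ edges N (d (suc t)) (d (suc (suc t))) →
      edges N (d (suc t)) (d (suc (suc t)))
    next M N t lt e (inj₂ e′) = e′
    next M N t lt e (inj₁ e′) = contradiction
      (inj (<-trans (m<n⇒m<1+n ≤-refl) lt) lt (disjoint M (symmetric M e) e′)) (m+1+n≢n 1 ∘ sym)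

    edge : ∀ t → suc t < m → edges (alternate X Y t) (d t) (d (suc t))
    edge zero    lt = first lt
    edge (suc t) lt with parity t in eq | edge t (<-trans ≤-refl lt)
    ... | 0ℙ | e = subst (λ M → edges M _ _) (sym (alternate-even t eq))
      (next X Y t lt (subst (λ M → edges M _ _) (alternate-even t eq) e) (in-union lt))
    ... | 1ℙ | e = subst (λ M → edges M _ _) (sym (alternate-odd t eq))
      (next Y X t lt (subst (λ M → edges M _ _) (alternate-odd t eq) e) ([ inj₂ , inj₁ ]′ (in-union lt)))

  -- The renumbered cycle D of an even switch may alternate starting with X or with
  -- Y, so no relation between its numbering and that of c is needed.
  step-cycle : ∀ {X Y} r {c last} → 2 ≤ r → Path X Y (r * 2) c → suc last ≡ r * 2 →
    edges Y (c last) (c 0) → Step X Y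
  step-cycle 1 (s≤s ()) _ _ _
  step-cycle 2 _ path refl close = step-square path close
  step-cycle {X} {Y} r@(suc (suc (suc _))) {c} _ path 1+last≡m close
    with switchable r (s≤s (s≤s (s≤s (s≤s (s≤s (s≤s z≤n)))))) C
    where C = closed-path-cycle (s≤s (s≤s (s≤s z≤n))) path 1+last≡m close
  ... | inj₁ (k , l , chord , 2∤) =
    step-odd-chord (closed-path-cycle (s≤s (s≤s (s≤s z≤n))) path 1+last≡m close) path (λ _ → refl)
      chord (2∤⇒parity≢ (toℕ k) (toℕ l) 2∤)
  ... | inj₂ (D , (_ , D⊆C) , i , j , switch , k , l , crossing) = by-first-edge (in-union (s≤s (s≤s z≤n)))
    where
    open Cycle D
    m = r * 2
    -- A path is indexed by all naturals; reduction modulo `m` extends the numbering of `D` and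
    -- changes nothing below `m`.
    d : ℕ → V
    d t = vertex (t mod m)
    toℕ-mod : ∀ {t} → t < m → toℕ (t mod m) ≡ t
    toℕ-mod lt = trans (toℕ-fromℕ< _) (m<n⇒m%n≡m lt)
    in-union : ∀ {t} → suc t < m → edges X (d t) (d (suc t)) ⊎ edges Y (d t) (d (suc t))
    in-union {t} lt = closed-path-edges (s≤s (s≤s (s≤s z≤n))) path 1+last≡m close
      (D⊆C (t mod m , suc t mod m ,
        inj₁ (trans (toℕ-mod lt) (cong suc (sym (toℕ-mod (<-trans ≤-refl lt))))) , inj₁ (refl , refl)))
    d-injective : ∀ {s t} → s < m → t < m → d s ≡ d t → s ≡ t
    d-injective s<m t<m e = trans (sym (toℕ-mod s<m)) (trans (cong toℕ (injective e)) (toℕ-mod t<m))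
    step-D : ∀ {A B} → Path A B m d → Step A B
    step-D path = step-even-switch r D path (λ i → cong vertex (toℕ-injective (toℕ-mod (toℕ<n i))))
      (s≤s (s≤s (s≤s (s≤s z≤n)))) switch crossing
    by-first-edge : edges X (d 0) (d 1) ⊎ edges Y (d 0) (d 1) → Step X Y
    by-first-edge (inj₁ e) = step-D (alternating in-union d-injective (λ _ → e))
    by-first-edge (inj₂ e) = step-sym (step-D (alternating ([ inj₂ , inj₁ ]′ ∘ in-union) d-injective (λ _ → e)))

  walk : PM → PM → V → ℕ → V
  walk X Y v zero    = v
  walk X Y v (suc t) = walk Y X (mate X v) t

  walk-edge : ∀ X Y v t → edges (alternate X Y t) (walk X Y v t) (walk X Y v (suc t))
  walk-edge X Y v zero    = mate-edge X v
  walk-edge X Y v (suc t) = walk-edge Y X (mate X v) t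

  -- Agreement at the `X`-mate of `v` would make the edge between them common to both matchings,
  -- hence force agreement at `v`.
  walk-differs : ∀ X Y {v} t → ¬ Agree X Y v → ¬ Agree X Y (walk X Y v t)
  walk-differs X Y zero    ¬a = ¬a
  walk-differs X Y {v} (suc t) ¬a = walk-differs Y X t
    (λ a → ¬a (agree-intro X Y (mate-edge X v)
      (symmetric Y (agree-edge X Y (sym a) (symmetric X (mate-edge X v)))))) ∘ sym

  module _ (X Y : PM) {v} (v-differs : ¬ Agree X Y v) where
    private
      w : ℕ → V
      w = walk X Y v

      Repeats : Pred ℕ 0ℓ
      Repeats t = ∃ λ s → s < t × w s ≡ w t

      repeats? : Decidable Repeats
      repeats? t = anyUpTo? (λ s → w s ≟ w t) t

      repetition : ∃ Repeats
      -- Positions of the walk are compared through their indices in `vertices`; one position more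
      -- than the length of the list forces a collision.
      repetition with i , j , i<j , e ← pigeonhole ≤-refl (λ k → index (complete (w (toℕ k)))) =
        toℕ j , toℕ i , i<j ,
        trans (lookup-index (complete (w (toℕ i))))
          (trans (cong (lookup vertices) e) (sym (lookup-index (complete (w (toℕ j))))))

      module _ {m i} (i<m : i < m) (return : w i ≡ w m) (first : ∀ {t} → t < m → ¬ Repeats t) where
        A B : PM
        A = alternate X Y i
        B = alternate Y X i

        e : ℕ → V
        e = w ∘ (i +_)

        path : Path A B (m ∸ i) e
        path = path-shift (record { edge = λ {t} _ → walk-edge X Y v t ; injective = inj }) i
          where
          inj : ∀ {s t} → s < m → t < m → w s ≡ w t → s ≡ t
          inj {s} {t} s<m t<m eq with <-cmp s t
          ... | tri< s<t _ _  = contradiction (s , s<t , eq) (first t<m)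
          ... | tri≈ _ s≡t _  = s≡t
          ... | tri> _ _ t<s  = contradiction (t , t<s , sym eq) (first s<m)

        returning : ∀ {g} → m ∸ i ≡ suc g → edges (alternate A B g) (e g) (e 0)
        returning {g} eq = subst₂ (λ M u → edges M (e g) u) (alternate-+ i g)
          (trans (cong w 1+i+g≡m) (trans (sym return) (cong w (sym (+-identityʳ i)))))
          (walk-edge X Y v (i + g))
          where
          1+i+g≡m : suc (i + g) ≡ m
          1+i+g≡m = trans (sym (+-suc i g)) (trans (cong (i +_) (sym eq)) (m+[n∸m]≡n (<⇒≤ i<m)))

        -- A closed part of odd length would have its first and last edges both in `A` and both at
        -- `e 0`. Length two would be an edge common to `A` and `B`, although they disagree all
        -- along the walk.
        step-return : Step A B
        step-return with m ∸ i in eq | path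
        ... | zero  | _ = contradiction (sym eq) (<⇒≢ (m<n⇒0<n∸m i<m))
        ... | suc g | p with parity g in g-parity
        ...   | 0ℙ = contradiction back (absurd g g-parity p)
          where
          back : edges A (e g) (e 0)
          back = subst (λ M → edges M (e g) (e 0)) (alternate-even g g-parity) (returning eq)
          absurd : ∀ g → parity g ≡ 0ℙ → Path A B (suc g) e → ¬ edges A (e g) (e 0)
          absurd zero          _    _ = unmatched-self A
          absurd (suc (suc h)) even p back with Path.injective p ≤-refl (s≤s (s≤s z≤n))
              (disjoint A (symmetric A back) (Path.edge p (s≤s (s≤s z≤n))))
          ... | ()
        ...   | 1ℙ with divides r 1+g≡r2 ← 2∣-even (suc g) (trans (parity-suc g) (cong _⁻¹ g-parity)) =
          step-cycle r (2≤r r 1+g≡r2) (subst (λ n → Path A B n e) 1+g≡r2 p) 1+g≡r2 back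
          where
          back : edges B (e g) (e 0)
          back = subst (λ M → edges M (e g) (e 0)) (alternate-odd g g-parity) (returning eq)
          2≤r : ∀ r → suc g ≡ r * 2 → 2 ≤ r
          2≤r (suc zero)    refl = contradiction
            (agree-unalternate X Y i (agree-intro A B (Path.edge p ≤-refl) (symmetric B back)))
            (walk-differs X Y (i + 0) v-differs)
          2≤r (suc (suc r)) _    = s≤s (s≤s z≤n)

    -- The walk may first return to a vertex other than v; the closed part is
    -- an alternating cycle all the same.
    step-differing : Step X Y
    step-differing with m , (i , i<m , return) , first ← least repeats? (proj₂ repetition) =
      step-alternate i (step-return i<m return first)

  reach-all : ∀ k X Y → distance X Y < k → Reach X Y
  reach-all (suc k) X Y (s≤s d≤k) with any? (¬? ∘ agree? X Y) vertices
  ... | yes some = step-differing X Y (proj₂ (satisfied some))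
    (λ {X′} {Y′} lt → reach-all k X′ Y′ (<-≤-trans lt d≤k))
  ... | no none = reach ε (⊆⇒≈ {X} {Y} λ {u} →
    agree-edge X Y (decidable-stable (agree? X Y u) (λ ¬a → none (lose (complete u) ¬a))))

  switchable⇒ergodic : Ergodic G
  switchable⇒ergodic X Y with reach ss ≈Y ← reach-all _ X Y ≤-refl = _ , ss , ≈Y

-- The cyclic successor on positions

next-exists : ∀ {m} (i : Fin m) → ∃ (Next i)
next-exists {suc m} i with suc (toℕ i) ℕ.≟ suc m
... | yes last = Fin.zero , inj₂ (last , refl)
... | no ¬last = Fin.fromℕ< 1+i<m , inj₁ (toℕ-fromℕ< 1+i<m)
  where 1+i<m = ≤∧≢⇒< (toℕ<n i) ¬last

previous-exists : ∀ {m} (j : Fin m) → ∃ λ i → Next i j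
previous-exists {suc m} Fin.zero    = Fin.fromℕ m , inj₂ (cong suc (Fin.toℕ-fromℕ m) , refl)
previous-exists {suc m} (Fin.suc j) = Fin.inject₁ j , inj₁ (cong suc (sym (Fin.toℕ-inject₁ j)))

next-functional : ∀ {m} {i j k : Fin m} → Next i j → Next i k → j ≡ k
next-functional (inj₁ e) (inj₁ e′) = toℕ-injective (trans e (sym e′))
next-functional {j = j} (inj₁ e) (inj₂ (e′ , _)) = contradiction (trans e e′) (<⇒≢ (toℕ<n j))
next-functional {k = k} (inj₂ (e′ , _)) (inj₁ e) = contradiction (trans e e′) (<⇒≢ (toℕ<n k))
next-functional (inj₂ (_ , e)) (inj₂ (_ , e′)) = toℕ-injective (trans e (sym e′))

next-injective : ∀ {m} {i j k : Fin m} → Next i k → Next j k → i ≡ j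
next-injective (inj₁ e) (inj₁ e′) = toℕ-injective (suc-injective (trans (sym e) e′))
next-injective (inj₁ e) (inj₂ (_ , e′)) = contradiction (trans (sym e) e′) λ ()
next-injective (inj₂ (_ , e′)) (inj₁ e) = contradiction (trans (sym e) e′) λ ()
next-injective (inj₂ (e , _)) (inj₂ (e′ , _)) = toℕ-injective (suc-injective (trans e (sym e′)))

next-asymmetric : ∀ {m} → 3 ≤ m → {i j : Fin m} → Next i j → ¬ Next j i
next-asymmetric _ {i} {j} (inj₁ e) (inj₁ e′) = m+1+n≢n 1 (trans (cong suc (sym e)) (sym e′))
next-asymmetric 3≤m (inj₁ e) (inj₂ (e′ , e″)) =
  <-irrefl (trans (cong (suc ∘ suc) (sym e″)) (trans (cong suc (sym e)) e′)) 3≤m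
next-asymmetric 3≤m (inj₂ (e′ , e″)) (inj₁ e) =
  <-irrefl (trans (cong (suc ∘ suc) (sym e″)) (trans (cong suc (sym e)) e′)) 3≤m
next-asymmetric 3≤m (inj₂ (e , _)) (inj₂ (_ , e′)) =
  <-irrefl (trans (cong suc (sym e′)) e) (<-trans ≤-refl 3≤m)

next? : ∀ {m} (i j : Fin m) → Dec (Next i j)
next? {m} i j = (toℕ j ℕ.≟ suc (toℕ i)) ⊎-dec ((suc (toℕ i) ℕ.≟ m) ×-dec (toℕ j ℕ.≟ 0))

parity-*2 : ∀ n → parity (n * 2) ≡ 0ℙ
parity-*2 zero    = refl
parity-*2 (suc n) = parity-*2 n

next-parity : ∀ r {i j : Fin (r * 2)} → Next i j → parity (toℕ j) ≡ parity (toℕ i) ⁻¹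
next-parity r {i} (inj₁ e) = trans (cong parity e) (parity-suc (toℕ i))
next-parity r {i} (inj₂ (e , e′)) =
  trans (cong parity e′) (trans (sym (parity-*2 r)) (trans (cong parity (sym e)) (parity-suc (toℕ i))))

parity≢⇒2∤ : ∀ m n → parity m ≢ parity n → 2 ∤ ∣ m - n ∣
parity≢⇒2∤ m n p≢q (divides q e) = p≢q (p+q≡0⇒p≡q
  (trans (sym (parity-∣-∣ m n)) (trans (cong parity e) (parity-*2 q))))

-- Saturated cuts are invariant under switches

module Cuts {V : Set} (_≟_ : DecidableEquality V) (G : Graph V)
            {In : Pred V 0ℓ} (In? : Decidable In) where
  open Graph G using (_~_; loopless) renaming (symmetric to ~-sym)
  open Matchings _≟_ G

  -- The edges leaving In join {q, s} to {p, t}; a perfect matching is saturated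
  -- if two of them belong to it.
  record Cut (q s p t : V) : Set where
    field
      q≢s  : q ≢ s
      q-in : In q
      s-in : In s
      p-out : ¬ In p
      t-out : ¬ In t
      crossing : ∀ {u v} → u ~ v → In u → ¬ In v → (u ≡ q ⊎ u ≡ s) × (v ≡ p ⊎ v ≡ t)
      not-both : q ~ s → ¬ p ~ t

  Saturated : V → V → V → V → Pred (PerfectMatching G) 0ℓ
  Saturated q s p t M = (edges M q p × edges M s t) ⊎ (edges M q t × edges M s p)

  flipˡ : ∀ {q s p t} → Cut q s p t → Cut s q p t
  flipˡ cut = record
    { q≢s = q≢s ∘ sym ; q-in = s-in ; s-in = q-in ; p-out = p-out ; t-out = t-out
    ; crossing = λ e i o → case crossing e i o of λ { (inj₁ a , b) → inj₂ a , b ; (inj₂ a , b) → inj₁ a , b }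
    ; not-both = not-both ∘ ~-sym }
    where open Cut cut

  flipʳ : ∀ {q s p t} → Cut q s p t → Cut q s t p
  flipʳ cut = record
    { q≢s = q≢s ; q-in = q-in ; s-in = s-in ; p-out = t-out ; t-out = p-out
    ; crossing = λ e i o → case crossing e i o of λ { (b , inj₁ a) → b , inj₂ a ; (b , inj₂ a) → b , inj₁ a }
    ; not-both = λ e → not-both e ∘ ~-sym }
    where open Cut cut

  -- A switch creating `q y` with `y` inside trades `q p` and some `w y` for `q y` and `w p`. If `w`
  -- is inside, `w p` crosses the cut, so `w` is `q` or `s` and its mate `y` would lie outside. If
  -- `w` is outside, `w y` crosses the cut, so `y` is `s` and `w` is `t`, and the new edges are the
  -- pair excluded by `not-both`.
  switch-leaves : ∀ M M′ → Switch G M M′ → ∀ {q s p t} → Cut q s p t → edges M q p → edges M s t →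
    ∀ {y} → edges M′ q y → ¬ In y
  switch-leaves M M′ (u , v , u′ , v′ , uv , u′v′ , _ , u′~v , u~v′ , M′⊆ , _)
    {q} {s} {p} {t} cut qp st {y} qy y-in =
    case M′⊆ qy of λ where
      (inj₁ (qy′ , _)) → p-out (subst In (disjoint M qy′ qp) y-in)
      (inj₂ (inj₁ (inj₁ (refl , refl)))) → impossible uv (subst (u ~_) (disjoint M u′v′ qp) u~v′)
      (inj₂ (inj₁ (inj₂ (refl , refl)))) →
        impossible (symmetric M u′v′) (~-sym (subst (_~ v′) (disjoint M (symmetric M uv) qp) u~v′))
      (inj₂ (inj₂ (inj₁ (refl , refl)))) → impossible u′v′ (subst (u′ ~_) (disjoint M uv qp) u′~v)
      (inj₂ (inj₂ (inj₂ (refl , refl)))) →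
        impossible (symmetric M uv) (~-sym (subst (_~ v) (disjoint M (symmetric M u′v′) qp) u′~v))
    where
    open Cut cut
    impossible : ∀ {w} → edges M w y → ¬ w ~ p
    impossible {w} wy w~p with In? w
    ... | yes w-in = case proj₁ (crossing w~p w-in p-out) of λ where
      (inj₁ refl) → p-out (subst In (disjoint M wy qp) y-in)
      (inj₂ refl) → t-out (subst In (disjoint M wy st) y-in)
    ... | no w-out = case proj₁ (crossing (~-sym (edges⊆E M wy)) y-in w-out) of λ where
      (inj₁ refl) → loopless (edges⊆E M′ qy)
      (inj₂ refl) → not-both (edges⊆E M′ qy) (~-sym (subst (_~ p) (disjoint M (symmetric M wy) st) w~p))

  module _ M M′ (switch : Switch G M M′) where

    -- Both `q` and `s` keep a mate outside, hence one of `p` and `t`, and they cannot share it. The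
    -- cut with both sides exchanged gives the argument for `s`.
    saturated-switch₁ : ∀ {q s p t} → Cut q s p t → edges M q p → edges M s t → Saturated q s p t M′
    saturated-switch₁ {q} {s} {p} {t} cut qp st = combine
      (mate-edge M′ q) (proj₂ (crossing (edges⊆E M′ (mate-edge M′ q)) q-in
        (switch-leaves M M′ switch cut qp st (mate-edge M′ q))))
      (mate-edge M′ s) (proj₂ (crossing (edges⊆E M′ (mate-edge M′ s)) s-in
        (switch-leaves M M′ switch (flipˡ (flipʳ cut)) st qp (mate-edge M′ s))))
      where
      open Cut cut
      combine : ∀ {y z} → edges M′ q y → y ≡ p ⊎ y ≡ t → edges M′ s z → z ≡ p ⊎ z ≡ t → Saturated q s p t M′
      combine qy (inj₁ refl) sz (inj₁ refl) = contradiction (disjointˡ M′ qy sz) q≢s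
      combine qy (inj₁ refl) sz (inj₂ refl) = inj₁ (qy , sz)
      combine qy (inj₂ refl) sz (inj₁ refl) = inj₂ (qy , sz)
      combine qy (inj₂ refl) sz (inj₂ refl) = contradiction (disjointˡ M′ qy sz) q≢s

    saturated-switch : ∀ {q s p t} → Cut q s p t → Saturated q s p t M → Saturated q s p t M′
    saturated-switch cut (inj₁ (qp , st)) = saturated-switch₁ cut qp st
    saturated-switch cut (inj₂ (qt , sp)) with saturated-switch₁ (flipʳ cut) qt sp
    ... | inj₁ e = inj₂ e
    ... | inj₂ e = inj₁ e

  saturated-star : ∀ {q s p t M N} → Cut q s p t → Star (Switch G) M N →
    Saturated q s p t M → Saturated q s p t N
  saturated-star cut ε        sat = sat
  saturated-star {M = M} cut (_◅_ {j = K} s ss) sat =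
    saturated-star cut ss (saturated-switch M K s cut sat)

-- From ergodic to switchable: a graph spanned by one even cycle

module HamiltonianCycle {V : Set} (_≟_ : DecidableEquality V) (G : Graph V) r (6≤m : 6 ≤ r * 2)
       (C : Cycle G (r * 2)) (pos : V → Fin (r * 2))
       (vertex-pos : ∀ v → Cycle.vertex C (pos v) ≡ v) where
  open Graph G using (_~_; _~?_) renaming (symmetric to ~-sym)
  open Matchings _≟_ G
  open Cycle C

  private
    m : ℕ
    m = r * 2

    pos-vertex : ∀ k → pos (vertex k) ≡ k
    pos-vertex k = injective (vertex-pos (vertex k))

    pos-injective : ∀ {u v} → pos u ≡ pos v → u ≡ v
    pos-injective e = trans (sym (vertex-pos _)) (trans (cong vertex e) (vertex-pos _))

  -- The cycle edges that start at a position of parity `b`. As the length is even, parity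
  -- alternates across the closing edge too, and the two values of `b` give the two perfect
  -- matchings of the cycle.
  HalfEdge : Parity → Rel (Fin m) 0ℓ
  HalfEdge b k l = (Next k l × parity (toℕ k) ≡ b) ⊎ (Next l k × parity (toℕ l) ≡ b)

  halfEdge-sym : ∀ {b k l} → HalfEdge b k l → HalfEdge b l k
  halfEdge-sym (inj₁ e) = inj₂ e
  halfEdge-sym (inj₂ e) = inj₁ e

  halfEdge-functional : ∀ {b k l l′} → HalfEdge b k l → HalfEdge b k l′ → l ≡ l′
  halfEdge-functional (inj₁ (n , _)) (inj₁ (n′ , _)) = next-functional n n′
  halfEdge-functional (inj₂ (n , _)) (inj₂ (n′ , _)) = next-injective n n′
  halfEdge-functional {b} (inj₁ (_ , e)) (inj₂ (n , e′)) =
    contradiction (trans (sym e) (trans (next-parity r n) (cong _⁻¹ e′))) (ℙ.p≢p⁻¹ b)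
  halfEdge-functional {b} (inj₂ (n , e′)) (inj₁ (_ , e)) =
    contradiction (trans (sym e) (trans (next-parity r n) (cong _⁻¹ e′))) (ℙ.p≢p⁻¹ b)

  halfEdge-covering : ∀ b k → ∃ (HalfEdge b k)
  halfEdge-covering b k with parity (toℕ k) ℙ.≟ b
  ... | yes e with l , n ← next-exists k = l , inj₁ (n , e)
  ... | no ¬e with l , n ← previous-exists k = l , inj₂ (n , flip (¬e ∘ trans (next-parity r n)))
    where
    flip : ∀ {p b} → p ⁻¹ ≢ b → p ≡ b
    flip {0ℙ} {0ℙ} _ = refl
    flip {0ℙ} {1ℙ} ≢b = contradiction refl ≢b
    flip {1ℙ} {0ℙ} ≢b = contradiction refl ≢b
    flip {1ℙ} {1ℙ} _ = refl

  halfEdge-adjacent : ∀ {b k l} → HalfEdge b k l → vertex k ~ vertex l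
  halfEdge-adjacent (inj₁ (n , _)) = adjacent n
  halfEdge-adjacent (inj₂ (n , _)) = ~-sym (adjacent n)

  half : Parity → PerfectMatching G
  half b = record
    { edges     = λ u v → HalfEdge b (pos u) (pos v)
    ; symmetric = halfEdge-sym
    ; edges⊆E   = λ {u} {v} e → subst₂ _~_ (vertex-pos u) (vertex-pos v) (halfEdge-adjacent e)
    ; disjoint  = λ e e′ → pos-injective (halfEdge-functional e e′)
    ; covering  = λ u → let l , e = halfEdge-covering b (pos u) in
        vertex l , subst (HalfEdge b (pos u)) (sym (pos-vertex l)) e
    }

  half-intro : ∀ {b k l} → HalfEdge b k l → edges (half b) (vertex k) (vertex l)
  half-intro {b} {k} {l} = subst₂ (HalfEdge b) (sym (pos-vertex k)) (sym (pos-vertex l))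

  half-elim : ∀ {b k l} → edges (half b) (vertex k) (vertex l) → HalfEdge b k l
  half-elim {b} {k} {l} = subst₂ (HalfEdge b) (pos-vertex k) (pos-vertex l)

  cycleEdges? : ∀ u v → Dec (cycleEdges u v)
  cycleEdges? u v = Fin.any? λ i → Fin.any? λ j → next? i j ×-dec
    (((u ≟ vertex i) ×-dec (v ≟ vertex j)) ⊎-dec ((u ≟ vertex j) ×-dec (v ≟ vertex i)))

  chord? : ∀ k l → Dec (Chord C k l)
  chord? k l = (vertex k ~? vertex l) ×-dec ¬? (cycleEdges? (vertex k) (vertex l))

  cycleEdge⇒next : ∀ {k l} → cycleEdges (vertex k) (vertex l) → Next k l ⊎ Next l k
  cycleEdge⇒next (i , j , n , inj₁ (e , e′)) = inj₁ (subst₂ Next (sym (injective e)) (sym (injective e′)) n)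
  cycleEdge⇒next (i , j , n , inj₂ (e , e′)) = inj₂ (subst₂ Next (sym (injective e′)) (sym (injective e)) n)

  hasOddChord? : Dec (HasOddChord C)
  hasOddChord? = Fin.any? λ k → Fin.any? λ l → chord? k l ×-dec ¬? (2 ∣? ∣ toℕ k - toℕ l ∣)

  Crossing : (i j : Fin r) → Rel (Fin m) 0ℓ
  Crossing i j = CrossingChord {r = r} C i j

  crossing? : ∀ i j → Dec (∃₂ (Crossing i j))
  crossing? i j = Fin.any? λ k → Fin.any? λ l → chord? k l ×-dec
    (¬? (pair? (left i) (left j) k l) ×-dec (¬? (pair? (right i) (right j) k l) ×-dec
    (((right i Fin.≤? k) ×-dec (k Fin.≤? left j)) ×-dec ((right j Fin.≤? l) ⊎-dec (l Fin.≤? left i)))))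
    where
    pair? : ∀ (a b k l : Fin m) → Dec (⟦ a , b ⟧ k l)
    pair? a b k l = ((k Fin.≟ a) ×-dec (l Fin.≟ b)) ⊎-dec ((k Fin.≟ b) ×-dec (l Fin.≟ a))

  next-left-right : ∀ i → Next (left i) (right i)
  next-left-right i = inj₁ (toℕ-right r i)

  right-odd : ∀ i → parity (toℕ (right i)) ≡ 1ℙ
  right-odd i = trans (next-parity r (next-left-right i)) (cong _⁻¹ (left-even r i))

  right<m : ∀ i → suc (toℕ (left i)) < m
  right<m i = subst (_< m) (toℕ-right r i) (toℕ<n (right i))

  half-pair : ∀ {u v} → edges (half 0ℙ) u v → ∃ λ i → ⟦ vertex (left i) , vertex (right i) ⟧ u v
  half-pair {u} {v} (inj₁ (n , e)) = let i , u≡ , v≡ = pair n e in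
    i , inj₁ (trans (sym (vertex-pos u)) (cong vertex u≡) , trans (sym (vertex-pos v)) (cong vertex v≡))
    where
    pair : ∀ {k l} → Next k l → parity (toℕ k) ≡ 0ℙ → ∃ λ i → k ≡ left i × l ≡ right i
    pair {k} n e with Fin.combine-surjective {r} {2} k
    ... | i , Fin.zero , refl = i , refl , next-functional n (next-left-right i)
    ... | i , Fin.suc Fin.zero , refl = contradiction (trans (sym e) (right-odd i)) 0≢1
  half-pair (inj₂ e) with half-pair (inj₁ e)
  ... | i , inj₁ (a , b) = i , inj₂ (b , a)
  ... | i , inj₂ (a , b) = i , inj₁ (b , a)

  module _ (no-odd : ¬ HasOddChord C) where

    private
      odd-adjacent : ∀ {k l} → parity (toℕ k) ≢ parity (toℕ l) → vertex k ~ vertex l → Next k l ⊎ Next l k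
      odd-adjacent {k} {l} ≢parity k~l with cycleEdges? (vertex k) (vertex l)
      ... | yes e = cycleEdge⇒next e
      ... | no ∉  = contradiction (k , l , (k~l , ∉) , parity≢⇒2∤ (toℕ k) (toℕ l) ≢parity) no-odd

      left≢right : ∀ i j → parity (toℕ (left i)) ≢ parity (toℕ (right j))
      left≢right i j e = 0≢1 (trans (sym (left-even r i)) (trans e (right-odd j)))

    -- Both pairs have opposite parities, so without odd chords they are cycle edges: the outer pair
    -- must be the closing edge and the inner pair consecutive positions. That leaves length four.
    no-odd-switch : ∀ {i j} → i Fin.< j → vertex (left i) ~ vertex (right j) → ¬ vertex (right i) ~ vertex (left j)
    no-odd-switch {i} {j} i<j lr rl = <-irrefl
      (trans (cong (suc ∘ suc) (trans (cong (suc ∘ suc) (sym (proj₁ outer))) (sym inner))) (proj₂ outer))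
      (<-trans ≤-refl 6≤m)
      where
      a = toℕ (left i)
      b = toℕ (left j)
      a<b : a < b
      a<b = left-mono-< r i<j
      outer : a ≡ 0 × suc (suc b) ≡ m
      outer with odd-adjacent (left≢right i j) lr
      ... | inj₁ (inj₁ e) = contradiction (suc-injective (trans (sym (toℕ-right r j)) e)) (>⇒≢ a<b)
      ... | inj₁ (inj₂ (_ , e)) = contradiction (trans (sym (toℕ-right r j)) e) λ ()
      ... | inj₂ (inj₁ e) = contradiction (trans e (cong suc (toℕ-right r j))) (<⇒≢ (m<n⇒m<1+n (m<n⇒m<1+n a<b)))
      ... | inj₂ (inj₂ (e , e′)) = e′ , trans (cong suc (sym (toℕ-right r j))) e
      inner : b ≡ suc (suc a)
      inner with odd-adjacent (left≢right j i ∘ sym) rl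
      ... | inj₁ (inj₁ e) = trans e (cong suc (toℕ-right r i))
      ... | inj₁ (inj₂ (_ , e)) = contradiction (subst (a <_) e a<b) n≮0
      ... | inj₂ (inj₁ e) = contradiction (suc-injective (trans (sym (toℕ-right r i)) e)) (<⇒≢ a<b)
      ... | inj₂ (inj₂ (e , _)) = contradiction e (<⇒≢ (right<m j))

    module _ {i j} (i<j : i Fin.< j) (no-crossing : ¬ ∃₂ (Crossing i j)) where
      private
        a b : ℕ
        a = toℕ (left i)
        b = toℕ (left j)

        a<b : a < b
        a<b = left-mono-< r i<j

        -- The vertex set of the path P₁ of the switch.
        In : Pred V 0ℓ
        In u = right i Fin.≤ pos u × pos u Fin.≤ left j

        In? : Decidable In
        In? u = (right i Fin.≤? pos u) ×-dec (pos u Fin.≤? left j)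

        ri = toℕ-right r i
        rj = toℕ-right r j

        outside : ∀ {v} → ¬ In v → right j Fin.≤ pos v ⊎ pos v Fin.≤ left i
        outside {v} ¬in with right i Fin.≤? pos v | pos v Fin.≤? left j
        ... | yes p | yes q = contradiction (p , q) ¬in
        ... | yes _ | no q  = inj₁ (subst (_≤ toℕ (pos v)) (sym rj) (≰⇒> q))
        ... | no p  | _     = inj₂ (s≤s⁻¹ (subst (toℕ (pos v) <_) ri (≰⇒> p)))

        at : ∀ {v k} → toℕ (pos v) ≡ toℕ k → v ≡ vertex k
        at {v} e = trans (sym (vertex-pos v)) (cong vertex (toℕ-injective e))

        at′ : ∀ {v k} → pos v ≡ k → v ≡ vertex k
        at′ e = at (cong toℕ e)

        End : V → V → Set
        End u v = (u ≡ vertex (right i) ⊎ u ≡ vertex (left j)) × (v ≡ vertex (left i) ⊎ v ≡ vertex (right j))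

        next-crossing : ∀ {u v} → In u → right j Fin.≤ pos v ⊎ pos v Fin.≤ left i →
          Next (pos u) (pos v) ⊎ Next (pos v) (pos u) → End u v
        next-crossing {u} {v} (i≤u , u≤j) (inj₁ j≤v) (inj₁ (inj₁ e)) =
          inj₂ (at (≤-antisym u≤j (s≤s⁻¹ (subst₂ _≤_ rj e j≤v)))) ,
          inj₂ (at (≤-antisym (subst₂ _≤_ (sym e) (sym rj) (s≤s u≤j)) j≤v))
        next-crossing {u} {v} (i≤u , u≤j) (inj₂ v≤i) (inj₁ (inj₁ e)) =
          contradiction (subst (a <_) (sym e) (m<n⇒m<1+n (subst (_≤ toℕ (pos u)) ri i≤u))) (≤⇒≯ v≤i)
        next-crossing (i≤u , u≤j) _ (inj₁ (inj₂ (e , _))) =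
          contradiction e (<⇒≢ (≤-<-trans (s≤s u≤j) (right<m j)))
        next-crossing {u} {v} (i≤u , u≤j) (inj₁ j≤v) (inj₂ (inj₁ e)) =
          contradiction (subst (b <_) (sym e) (m<n⇒m<1+n (subst (_≤ toℕ (pos v)) rj j≤v))) (≤⇒≯ u≤j)
        next-crossing {u} {v} (i≤u , u≤j) (inj₂ v≤i) (inj₂ (inj₁ e)) =
          inj₁ (at (≤-antisym (subst₂ _≤_ (sym e) (sym ri) (s≤s v≤i)) i≤u)) ,
          inj₁ (at (≤-antisym v≤i (s≤s⁻¹ (subst₂ _≤_ ri e i≤u))))
        next-crossing {u} (i≤u , _) _ (inj₂ (inj₂ (_ , e))) =
          contradiction (subst₂ _≤_ ri e i≤u) n≮0

        -- A cycle edge leaving P₁ is one of the two deleted edges; a chord leaving it would be a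
        -- crossing chord unless it belongs to the switch.
        cut-crossing : ∀ {u v} → u ~ v → In u → ¬ In v → End u v
        cut-crossing {u} {v} u~v in-u@(i≤u , u≤j) ¬in-v with cycleEdges? (vertex (pos u)) (vertex (pos v))
        ... | yes e = next-crossing in-u (outside ¬in-v) (cycleEdge⇒next e)
        ... | no ∉ with (pos u Fin.≟ left j) ×-dec (pos v Fin.≟ left i)
                      | (pos u Fin.≟ right i) ×-dec (pos v Fin.≟ right j)
        ...   | yes (e , e′) | _ = inj₂ (at′ e) , inj₁ (at′ e′)
        ...   | no _ | yes (e , e′) = inj₁ (at′ e) , inj₂ (at′ e′)
        ...   | no ≢left | no ≢right = contradiction
          (pos u , pos v , (subst₂ _~_ (sym (vertex-pos u)) (sym (vertex-pos v)) u~v , ∉) ,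
            -- Read in the opposite direction, the chords of the switch would put `left i` or
            -- `right j` on P₁.
            (λ { (inj₁ (e , _)) → 1+n≰n (subst₂ _≤_ ri (cong toℕ e) i≤u) ; (inj₂ e) → ≢left e }) ,
            (λ { (inj₁ e) → ≢right e ; (inj₂ (e , _)) → 1+n≰n (subst (_≤ b) (trans (cong toℕ e) rj) u≤j) }) ,
            in-u , outside ¬in-v) no-crossing

      open Cuts _≟_ G In?

      private
        pos-≡ : ∀ k → toℕ (pos (vertex k)) ≡ toℕ k
        pos-≡ k = cong toℕ (pos-vertex k)

        cut : Cut (vertex (right i)) (vertex (left j)) (vertex (left i)) (vertex (right j))
        cut = record
          { q≢s      = λ e → left≢right j i (cong (parity ∘ toℕ) (sym (injective e)))
          ; q-in     = ≤-reflexive (sym (pos-≡ (right i))) , subst₂ _≤_ (sym (trans (pos-≡ (right i)) ri)) refl a<b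
          ; s-in     = subst₂ _≤_ (sym ri) (sym (pos-≡ (left j))) a<b , ≤-reflexive (pos-≡ (left j))
          ; p-out    = λ (e , _) → 1+n≰n (subst₂ _≤_ ri (pos-≡ (left i)) e)
          ; t-out    = λ (_ , e) → 1+n≰n (subst (_≤ b) (trans (pos-≡ (right j)) rj) e)
          ; crossing = cut-crossing
          ; not-both = λ rl lr → no-odd-switch i<j lr rl
          }

        SaturatedSwitch : Pred PM 0ℓ
        SaturatedSwitch = Saturated (vertex (right i)) (vertex (left j)) (vertex (left i)) (vertex (right j))

        saturated-half : SaturatedSwitch (half 0ℙ)
        saturated-half = inj₁ (half-intro (inj₂ (next-left-right i , left-even r i)) ,
                               half-intro (inj₁ (next-left-right j , left-even r j)))

        unsaturated-half : ¬ SaturatedSwitch (half 1ℙ)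
        unsaturated-half (inj₁ (e , _)) with half-elim {1ℙ} {right i} {left i} e
        ... | inj₁ (n , _) = next-asymmetric (Cycle.3≤m C) (next-left-right i) n
        ... | inj₂ (_ , e) = 0≢1 (trans (sym (left-even r i)) e)
        unsaturated-half (inj₂ (e , _)) with half-elim {1ℙ} {right i} {right j} e
        ... | inj₁ (n , _) = ℙ.p≢p⁻¹ 1ℙ (trans (sym (right-odd j)) (trans (next-parity r n) (cong _⁻¹ (right-odd i))))
        ... | inj₂ (n , _) = ℙ.p≢p⁻¹ 1ℙ (trans (sym (right-odd i)) (trans (next-parity r n) (cong _⁻¹ (right-odd j))))

      uncrossed⇒unreachable : ∀ {N} → Star (Switch G) (half 0ℙ) N → ¬ N ≈ half 1ℙ
      uncrossed⇒unreachable {N} ss (N⊆ , _) with saturated-star {M = half 0ℙ} {N} cut ss saturated-half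
      ... | inj₁ (e , e′) = unsaturated-half (inj₁ (N⊆ e , N⊆ e′))
      ... | inj₂ (e , e′) = unsaturated-half (inj₂ (N⊆ e , N⊆ e′))

    private
      sort : ∀ {i j} → i ≢ j → vertex (left i) ~ vertex (left j) → vertex (right i) ~ vertex (right j) →
        ∃₂ (EvenSwitch {r = r} C)
      sort {i} {j} i≢j ll rr with Fin.<-cmp i j
      ... | tri< i<j _ _ = i , j , i<j , ll , rr
      ... | tri≈ _ e _   = contradiction e i≢j
      ... | tri> _ _ j<i = j , i , j<i , ~-sym ll , ~-sym rr

      not-odd : ∀ {i j} → i ≢ j → vertex (left i) ~ vertex (right j) → ¬ vertex (right i) ~ vertex (left j)
      not-odd {i} {j} i≢j lr rl with Fin.<-cmp i j
      ... | tri< i<j _ _ = no-odd-switch i<j lr rl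
      ... | tri≈ _ e _   = i≢j e
      ... | tri> _ _ j<i = no-odd-switch j<i (~-sym rl) (~-sym lr)

    -- The relation `Switch` lists each removed edge in either direction. Equal directions would
    -- create both diagonals, which `not-odd` forbids; opposite directions create the two even
    -- chords.
    switch⇒evenSwitch : ∀ {N} → Switch G (half 0ℙ) N → ∃₂ (EvenSwitch {r = r} C)
    switch⇒evenSwitch (u , v , u′ , v′ , uv , u′v′ , ≢ , u′~v , u~v′ , _) with half-pair uv | half-pair u′v′
    ... | i , inj₁ (refl , refl) | j , inj₁ (refl , refl) =
      contradiction (~-sym u′~v) (not-odd (λ { refl → ≢ (inj₁ (refl , refl)) }) u~v′)
    ... | i , inj₁ (refl , refl) | j , inj₂ (refl , refl) =
      sort (λ { refl → ≢ (inj₂ (refl , refl)) }) u~v′ (~-sym u′~v)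
    ... | i , inj₂ (refl , refl) | j , inj₁ (refl , refl) =
      sort (λ { refl → ≢ (inj₂ (refl , refl)) }) (~-sym u′~v) u~v′
    ... | i , inj₂ (refl , refl) | j , inj₂ (refl , refl) =
      contradiction u~v′ (not-odd (λ { refl → ≢ (inj₁ (refl , refl)) }) (~-sym u′~v))

  half-differs : ¬ half 0ℙ ≈ half 1ℙ
  half-differs (⊆ , _) with half-elim {1ℙ} {k₀} {k₁} (⊆ (half-intro (inj₁ (n , cong parity k₀≡0))))
    where
    k₀ : Fin m
    k₀ = Fin.fromℕ< (<-≤-trans (s≤s z≤n) 6≤m)
    k₀≡0 : toℕ k₀ ≡ 0
    k₀≡0 = toℕ-fromℕ< _
    k₁ = proj₁ (next-exists k₀)
    n = proj₂ (next-exists k₀)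
  ... | inj₁ (_ , e) = 0≢1 (trans (sym (cong parity (toℕ-fromℕ< (<-≤-trans (s≤s z≤n) 6≤m)))) e)
  ... | inj₂ (n′ , _) = next-asymmetric (Cycle.3≤m C) (proj₂ (next-exists _)) n′

  -- No renumbering is involved: `half 0ℙ` consists of the edges from `left i` to `right i`, so the
  -- first switch is an even switch in the given numbering of `C`.
  ergodic⇒switch : Ergodic G → HasOddChord C ⊎
    ∃₂ λ (i j : Fin r) → EvenSwitch {r = r} C i j × ∃₂ (CrossingChord {r = r} C i j)
  ergodic⇒switch ergodic with hasOddChord?
  ... | yes odd = inj₁ odd
  ... | no no-odd with ergodic (half 0ℙ) (half 1ℙ)
  ...   | _ , ε , X≈Y = contradiction X≈Y half-differs
  ...   | N , ss@(_◅_ {j = K} s _) , N≈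
          with i , j , switch@(i<j , _) ← switch⇒evenSwitch no-odd {K} s with crossing? i j
  ...     | yes crossing = inj₂ (i , j , switch , crossing)
  ...     | no none = contradiction N≈ (uncrossed⇒unreachable no-odd i<j none {N} ss)

-- Passage between a graph and its induced subgraphs

module InducedSubgraph {n} (G : Graph (Fin n)) (U : Subset n) where
  open Graph G using (_~_)

  Vertex : Set
  Vertex = Σ (Fin n) (Subset._∈ U)

  vertex-≡ : {u v : Vertex} → proj₁ u ≡ proj₁ v → u ≡ v
  vertex-≡ {u , p} {_ , q} refl = cong (u ,_) ([]=-irrelevant p q)

  _≟_ : DecidableEquality Vertex
  u ≟ v with proj₁ u Fin.≟ proj₁ v
  ... | yes e = yes (vertex-≡ e)
  ... | no ¬e = no (¬e ∘ cong proj₁)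

  private
    select : Fin n → List Vertex
    select k with k ∈? U
    ... | yes p = (k , p) ∷ []
    ... | no _  = []

  vertices : List Vertex
  vertices = concatMap select (allFin n)

  complete : ∀ v → v ∈ vertices
  complete (k , p) = ∈-concatMap⁺ select (lose (∈-allFin k) selected)
    where
    selected : (k , p) ∈ select k
    selected with k ∈? U
    ... | yes _ = here (vertex-≡ refl)
    ... | no ∉  = contradiction p ∉

  module _ {m} (C : Cycle (G [ U ]) m) where
    open Cycle C

    ↑ : Cycle G m
    ↑ = record
      { 3≤m       = 3≤m
      ; vertex    = proj₁ ∘ vertex
      ; injective = injective ∘ vertex-≡
      ; adjacent  = adjacent
      }

    ↑-edges : ∀ {u v} → cycleEdges u v → Cycle.cycleEdges ↑ (proj₁ u) (proj₁ v)
    ↑-edges (i , j , n , inj₁ (e , e′)) = i , j , n , inj₁ (cong proj₁ e , cong proj₁ e′)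
    ↑-edges (i , j , n , inj₂ (e , e′)) = i , j , n , inj₂ (cong proj₁ e , cong proj₁ e′)

    ↓-edges : ∀ {u v} → Cycle.cycleEdges ↑ (proj₁ u) (proj₁ v) → cycleEdges u v
    ↓-edges (i , j , n , inj₁ (e , e′)) = i , j , n , inj₁ (vertex-≡ e , vertex-≡ e′)
    ↓-edges (i , j , n , inj₂ (e , e′)) = i , j , n , inj₂ (vertex-≡ e , vertex-≡ e′)

    ↑-chord : ∀ {k l} → Chord C k l → Chord ↑ k l
    ↑-chord (e , ∉) = e , ∉ ∘ ↓-edges

    ↓-chord : ∀ {k l} → Chord ↑ k l → Chord C k l
    ↓-chord (e , ∉) = e , ∉ ∘ ↑-edges

    cycleEdge-in : ∀ {x y} → Cycle.cycleEdges ↑ x y → x Subset.∈ U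
    cycleEdge-in (i , _ , _ , inj₁ (refl , _)) = proj₂ (vertex i)
    cycleEdge-in (_ , j , _ , inj₂ (refl , _)) = proj₂ (vertex j)

  -- The renumbering `D` supplied for the cycle in `G` has the same edges, so all its vertices lie
  -- in `U` and it can be read as a cycle of `G [ U ]`.
  switchable-induced : Switchable G → Switchable (G [ U ])
  switchable-induced switchable r 6≤m C with switchable r 6≤m (↑ C)
  ... | inj₁ (k , l , chord , 2∤) = inj₁ (k , l , ↓-chord C chord , 2∤)
  ... | inj₂ (D , (C⊆D , D⊆C) , i , j , switch , k , l , chord , rest) =
    inj₂ (D↓ , (↓-edges D↓ ∘ C⊆D ∘ ↑-edges C , ↓-edges C ∘ D⊆C ∘ ↑-edges D↓) ,
      i , j , switch , k , l , ↓-chord D↓ chord , rest)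
    where
    open Cycle D
    in-U : ∀ i → vertex i Subset.∈ U
    in-U i with j , n ← next-exists i = cycleEdge-in C (D⊆C (i , j , n , inj₁ (refl , refl)))
    D↓ : Cycle (G [ U ]) (r * 2)
    D↓ = record
      { 3≤m       = 3≤m
      ; vertex    = λ i → vertex i , in-U i
      ; injective = injective ∘ cong proj₁
      ; adjacent  = adjacent
      }

module _ {n} {G : Graph (Fin n)} {m} (C : Cycle G m) where
  open Cycle C

  private
    on? : ∀ x → Dec (∃ λ k → vertex k ≡ x)
    on? x = Fin.any? λ k → vertex k Fin.≟ x

  support : Subset n
  support = tabulate (does ∘ on?)

  vertex∈support : ∀ k → vertex k Subset.∈ support
  vertex∈support k = lookup⇒[]= (vertex k) support
    (trans (lookup∘tabulate (does ∘ on?) (vertex k)) (dec-true (on? (vertex k)) (k , refl)))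

  support⇒vertex : ∀ {x} → x Subset.∈ support → ∃ λ k → vertex k ≡ x
  support⇒vertex {x} x∈ with on? x | trans (sym (lookup∘tabulate (does ∘ on?) x)) ([]=⇒lookup x∈)
  ... | yes on | _ = on
  ... | no _   | ()

  support-cycle : Cycle (G [ support ]) m
  support-cycle = record
    { 3≤m       = 3≤m
    ; vertex    = λ k → vertex k , vertex∈support k
    ; injective = injective ∘ cong proj₁
    ; adjacent  = adjacent
    }

theorem1 : ∀ (n : ℕ) (G : Graph (Fin n)) → HereditarilyErgodic G ⇔ Switchable G
theorem1 n G = mk⇔ to from
  where
  to : HereditarilyErgodic G → Switchable G
  to ergodic r 6≤m C with HamiltonianCycle.ergodic⇒switch _≟_ (G [ U ]) r 6≤m C′
      (λ (_ , x∈U) → proj₁ (support⇒vertex C x∈U))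
      (λ (_ , x∈U) → vertex-≡ (proj₂ (support⇒vertex C x∈U))) (ergodic U)
    where
    U = support C
    C′ = support-cycle C
    open InducedSubgraph G U
  ... | inj₁ (k , l , chord , 2∤) = inj₁ (k , l , InducedSubgraph.↑-chord G _ (support-cycle C) chord , 2∤)
  ... | inj₂ (i , j , switch , k , l , chord , rest) =
    inj₂ (C , (id , id) , i , j , switch , k , l , InducedSubgraph.↑-chord G _ (support-cycle C) chord , rest)

  from : Switchable G → HereditarilyErgodic G
  from switchable U = Ergodicity.switchable⇒ergodic _≟_ (G [ U ]) vertices complete (switchable-induced switchable)
    where open InducedSubgraph G U
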